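{- Let $q$ be a prime power, let $m\ge1$, $s\ge1$, $u\ge0$ and $r\ge2$ be integers, and let $\mathbf{e}=(e_1,\dots,e_s)\in\mathbb{N}^s$. If there exists a digital $(u,m,\mathbf{e},s)$-net over $\mathbb{F}_{q^r}$, then there exists a digital $((r-1)m-(r-1)+u,\ rm-(r-1),\ \mathbf{e},\ s)$-net over $\mathbb{F}_q$.
   Context: $\mathbb{N}$ denotes the positive integers, $\lambda_s$ Lebesgue measure. An elementary interval in base $b$ is $J=\prod_{i=1}^s[a_ib^{ -d_i},(a_i+1)b^{ -d_i})$ with integers $d_i\ge0$, $0\le a_i<b^{d_i}$. For integers $0\le u\le m$ and $\mathbf{e}=(e_1,\dots,e_s)\in\mathbb{N}^s$, a set of $b^m$ points in $[0,1)^s$ is a $(u,m,\mathbf{e},s)$-net in base $b$ if every elementary interval $J$ in base $b$ with $\lambda_s(J)\ge b^{u-m}$ and $e_i\mid d_i$ for all $i$ contains exactly $b^m\lambda_s(J)$ of the points. Digital net over a finite field $\mathbb{F}_Q$ ($Q$ a prime power): given $m\times m$ generating matrices $C_1,\dots,C_s$ over $\mathbb{F}_Q$, bijections $\eta_r:Z_Q\to\mathbb{F}_Q$ ($0\le r<m$) and $\kappa_{i,j}:\mathbb{F}_Q\to Z_Q$ where $Z_Q=\{0,\dots,Q-1\}$, for $0\le n<Q^m$ with base-$Q$ digits $n_0,\dots,n_{m-1}$ put $(y^{(i)}_{n,1},\dots,y^{(i)}_{n,m})^\top=C_i(\eta_0(n_0),\dots,\eta_{m-1}(n_{m-1}))^\top$,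 $x_n^{(i)}=\sum_{j=1}^m\kappa_{i,j}(y^{(i)}_{n,j})Q^{ -j}$, $\mathbf{x}_n=(x_n^{(1)},\dots,x_n^{(s)})$. The resulting point set is a digital net over $\mathbb{F}_Q$; it is a digital $(u,m,\mathbf{e},s)$-net over $\mathbb{F}_Q$ if it is a $(u,m,\mathbf{e},s)$-net in base $Q$. -}

module Defs where

open import Level using (Level; suc; _⊔_)
open import Data.Nat as ℕ using (ℕ; zero; _+_; _*_; _∸_; _^_; _≤_; _<_; _/_; _%_)
open import Data.Nat.Primality using (Prime)
open import Data.Nat.Divisibility using (_∣_)
open import Data.Fin as Fin using (Fin; toℕ)
open import Data.Fin.Properties using (any?)
open import Data.Product using (Σ; ∃; _×_; _,_)
open import Data.Vec.Functional using (Vector)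
open import Relation.Binary.PropositionalEquality using (_≡_; _≢_)
open import Relation.Nullary using (Dec; yes; no; ¬_)
open import Relation.Nullary.Decidable using (_×-dec_)
open import Algebra.Structures using (IsCommutativeRing)
open import Function.Bundles using (_⤖_; Bijection)

IsPrimePower : ℕ → Set
IsPrimePower q = Σ ℕ λ p → Σ ℕ λ k → Prime p × 1 ≤ k × q ≡ p ^ k

record FiniteField (Q : ℕ) : Set₁ where
  infixl 7 _*F_
  infixl 6 _+F_
  field
    Carrier : Set
    _+F_ _*F_ : Carrier → Carrier → Carrier
    -F_ : Carrier → Carrier
    0F 1F : Carrier
    isCommutativeRing : IsCommutativeRing _≡_ _+F_ _*F_ -F_ 0F 1F
    0≢1 : 0F ≢ 1F
    inverse : ∀ x → x ≢ 0F → Σ Carrier λ y → x *F y ≡ 1F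
    enumeration : Fin Q ⤖ Carrier

sumℕ : ∀ {n} → (Fin n → ℕ) → ℕ
sumℕ {zero}    f = 0
sumℕ {ℕ.suc n} f = f Fin.zero + sumℕ (λ i → f (Fin.suc i))

count : ∀ {n} {P : Fin n → Set} → (∀ i → Dec (P i)) → ℕ
count {zero}    P? = 0
count {ℕ.suc n} P? with P? Fin.zero
... | yes _ = ℕ.suc (count (λ i → P? (Fin.suc i)))
... | no  _ = count (λ i → P? (Fin.suc i))

-- (u,m,e,s)-nets in base b.
-- A point set of b^m points in [0,1)^s whose coordinates are of the
-- form X / b^m is given by the numerators:  X n i  for n < b^m, i < s,
-- representing the point x_n = (X n 1 / b^m, ..., X n s / b^m).
-- (All digital nets with m×m matrices have this form.)

-- an elementary interval  ∏ [a_i b^{-d_i}, (a_i+1) b^{-d_i})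
record ElemInterval (b s : ℕ) : Set where
  constructor elem
  field
    d : Fin s → ℕ
    a : Fin s → ℕ
    a<b^d : ∀ i → a i < b ^ d i

-- x = X / b^m lies in [a b^{-d}, (a+1) b^{-d})
--   ⇔  a b^m ≤ X b^d < (a+1) b^m
InCoord : (b m d a X : ℕ) → Set
InCoord b m d a X = a * b ^ m ≤ X * b ^ d × X * b ^ d < (1 + a) * b ^ m

inCoord? : ∀ b m d a X → Dec (InCoord b m d a X)
inCoord? b m d a X = (a * b ^ m ℕ.≤? X * b ^ d) ×-dec (X * b ^ d ℕ.<? (1 + a) * b ^ m)

allFin? : ∀ {n} {P : Fin n → Set} → (∀ i → Dec (P i)) → Dec (∀ i → P i)
allFin? = Data.Fin.Properties.all?
  where import Data.Fin.Properties

InBox : ∀ {b s m} → ElemInterval b s → (Fin s → ℕ) → Set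
InBox {b} {s} {m} J x = ∀ i → InCoord b m (ElemInterval.d J i) (ElemInterval.a J i) (x i)

inBox? : ∀ {b s m} (J : ElemInterval b s) (x : Fin s → ℕ) → Dec (InBox {b} {s} {m} J x)
inBox? {b} {s} {m} J x = allFin? λ i → inCoord? b m (ElemInterval.d J i) (ElemInterval.a J i) (x i)

-- (u,m,e,s)-net in base b: 0 ≤ u ≤ m, and every elementary interval J
-- with λ_s(J) = b^{-Σ d_i} ≥ b^{u-m} (i.e. b^{u + Σ d_i} ≤ b^m) and
-- e_i ∣ d_i contains exactly b^m λ_s(J) points
-- (i.e. #points · b^{Σ d_i} = b^m).
IsNet : (b u m s : ℕ) (e : Fin s → ℕ) → (X : Fin (b ^ m) → Fin s → ℕ) → Set
IsNet b u m s e X =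
  u ≤ m ×
  ((J : ElemInterval b s) →
     let D = sumℕ (ElemInterval.d J) in
     b ^ (u + D) ≤ b ^ m →
     (∀ i → e i ∣ ElemInterval.d J i) →
     count (λ n → inBox? {b} {s} {m} J (X n)) * b ^ D ≡ b ^ m)

module _ {Q : ℕ} (F : FiniteField Q) where
  open FiniteField F

  sumF : ∀ {n} → (Fin n → Carrier) → Carrier
  sumF {zero}    f = 0F
  sumF {ℕ.suc n} f = f Fin.zero +F sumF (λ i → f (Fin.suc i))

  Q-nonZero : ℕ.NonZero Q
  Q-nonZero = nz (Data.Product.proj₁ (Bijection.surjective enumeration 0F))
    where
      import Data.Product
      nz : ∀ {Q'} → Fin Q' → ℕ.NonZero Q'
      nz Fin.zero    = _
      nz (Fin.suc _) = _

  instance _ = Q-nonZero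

  digit : (n r : ℕ) → Fin Q
  digit n zero      = Fin.fromℕ< (Data.Nat.DivMod.m%n<n n Q)
    where import Data.Nat.DivMod
  digit n (ℕ.suc r) = digit (n / Q) r

  record DigitalData (m s : ℕ) : Set where
    field
      C : Fin s → Fin m → Fin m → Carrier
      η : Fin m → Fin Q ⤖ Carrier
      κ : Fin s → Fin m → Carrier ⤖ Fin Q

  -- numerator of x_n^{(i)} (times Q^m):
  --   y^{(i)}_n = C_i (η_0(n_0), ..., η_{m-1}(n_{m-1}))^T
  --   x^{(i)}_n = Σ_{j=1}^m κ_{i,j}(y^{(i)}_{n,j}) Q^{-j}
  --   Q^m x^{(i)}_n = Σ_{j=0}^{m-1} κ_{i,j}(y_{n,j}) Q^{m-1-j}   (0-based j)
  digitalPoints : ∀ {m s} → DigitalData m s → Fin (Q ^ m) → Fin s → ℕ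
  digitalPoints {m} {s} D n i =
    sumℕ λ (j : Fin m) →
      toℕ (Bijection.to (κ i j) (y j)) * Q ^ (m ∸ 1 ∸ toℕ j)
    where
      open DigitalData D
      y : Fin m → Carrier
      y j = sumF λ (k : Fin m) → C i j k *F Bijection.to (η k) (digit (toℕ n) (toℕ k))

  ExistsDigitalNet : (u m s : ℕ) (e : Fin s → ℕ) → Set
  ExistsDigitalNet u m s e =
    Σ (DigitalData m s) λ D →
      IsNet Q u m s e (digitalPoints D)

module Submission where

{- A field of order q embeds in every field of order q^r: write F = 𝔽_p[α], where α ∈ F satisfies
   α^(p^j) ≠ α for 0 < j < k and q = p^k; the minimal polynomial of α over 𝔽_p has a root β in the larger
   field E, and f(α) ↦ f(β) is the embedding φ. The same choice of generator gives a basis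
   1, γ, …, γ^(r−1) of E over φ(F), and the first coordinate with respect to it is an F-linear
   retraction π of φ.

   The net condition says that for all admissible (d_i) the first d_i rows c of the matrices C_i make
   v ↦ (⟨c, v⟩) surjective. Scale every row so that its leading entry lies in {0,1} ⊆ F. Then the F-linear
   functional v ↦ π⟨c, v⟩ on E^m depends on the first entry of v only through its image under π, so it
   factors through F × E^(m−1) ≅ F^(1+r(m−1)). This is where the r − 1 dimensions are saved, and joint
   surjectivity is inherited by the new functionals. -}

-- The two fields are given abstractly and with no map between them, so the embedding has to be
-- built from their orders alone. Polynomials over the prime field are represented by coefficient
-- vectors in ℕ, because these can be evaluated in F and in E alike; vectors of length k that agree
-- at α agree modulo p, hence at every point of E. The root β then comes from division with
-- remainder and a count of roots. The parameters fit for the following reason. The new dimension 1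
-- + r(m-1) exceeds m by (r-1)(m-1), which is exactly the increase of u. So the vectors (d_i) that
-- the new net must handle are ones that the old net already handles, and none of their entries
-- exceeds m. A target τ over F is reached by solving over E for φ(τ), corrected by the scaling of
-- the rows, and then applying π.

open import Defs
open import Algebra.Bundles using (CommutativeMonoid; CommutativeRing)
open import Data.Empty using (⊥)
open import Data.Fin as Fin
  using ( Fin; zero; suc; toℕ; fromℕ<; inject₁; inject≤; punchOut; _↑ˡ_; _↑ʳ_
        ; combine; remQuot; funToFin; finToFun; splitAt)
open import Data.Fin.Permutation using (Permutation; permutation; _⟨$⟩ʳ_)
import Data.Fin.Properties as Fin
open import Data.Nat as ℕ using (ℕ; zero; suc; _∸_; _≤_; _<_; z≤n; s≤s; NonZero)
open import Data.Nat.Combinatorics using (_C_; k![n∸k]!∣n!; nCk≡n!/k![n-k]!; nCn≡1)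
open import Data.Nat.Coprimality using (prime⇒coprime; coprime-Bézout)
open import Data.Nat.DivMod
  using ( _%_; _/_; m≡m%n+[m/n]*n; m%n<n; [m+kn]%n≡m%n; m<n⇒m%n≡m; m<n⇒m/n≡0; m*n/n≡m; m/n*n≡m
        ; m<n*o⇒m/o<n; +-distrib-/-∣ʳ)
open import Data.Nat.Divisibility using (_∣_; divides; ∣⇒≤; m∣m*n; n∣m*n)
open import Data.Nat.GCD using (module Bézout)
open import Data.Nat.Primality using (Prime; euclidsLemma; prime⇒nonZero; prime⇒nonTrivial)
import Data.Nat.Properties as ℕ
open import Data.Product using (∃; Σ; _×_; _,_; proj₁; proj₂; uncurry)
open import Data.Sum using (_⊎_; inj₁; inj₂; [_,_]′)
open import Data.Vec.Functional using (removeAt)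
open import Function using (_∘_; id; Injective; Bijection; mk⤖)
open import Level using (0ℓ)
open import Relation.Binary.Definitions using (tri<; tri≈; tri>)
open import Relation.Binary.PropositionalEquality
  using (_≡_; _≢_; _≗_; refl; sym; trans; cong; cong₂; subst; subst₂; module ≡-Reasoning)
open import Relation.Nullary using (Dec; yes; no; ¬_; contradiction)
open import Relation.Nullary.Decidable using (map′; ¬?; _⊎-dec_; decidable-stable)

-- Finite sums, counting of decidable predicates, binomial coefficients modulo a prime

module Counting where
  open import Data.Nat using (_+_; _*_; _^_)

  module _ {a ℓ} (M : CommutativeMonoid a ℓ) where
    open CommutativeMonoid M hiding (refl; sym; trans)
    open CommutativeMonoid M using () renaming (refl to ≈-refl; sym to ≈-sym; trans to ≈-trans)
    open import Algebra.Properties.CommutativeMonoid.Sum M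
    open import Relation.Binary.Reasoning.Setoid setoid

    sum-zero : ∀ {n} (f : Fin n → Carrier) → (∀ i → f i ≈ ε) → sum f ≈ ε
    sum-zero {n} f f≈ε = ≈-trans (sum-cong-≋ f≈ε) (sum-replicate-zero n)

    sum-single : ∀ {n} (f : Fin n → Carrier) k → (∀ i → i ≢ k → f i ≈ ε) → sum f ≈ f k
    sum-single {suc n} f k off = begin
      sum f                     ≈⟨ sum-remove {i = k} f ⟩
      f k ∙ sum (removeAt f k)  ≈⟨ ∙-congˡ (sum-zero _ (λ i → off _ (Fin.punchInᵢ≢i k i))) ⟩
      f k ∙ ε                   ≈⟨ identityʳ _ ⟩
      f k                       ∎

    sum-splitAt : ∀ m {n} (f : Fin (m + n) → Carrier) →
                  sum f ≈ sum (f ∘ (_↑ˡ n)) ∙ sum (f ∘ (m ↑ʳ_))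
    sum-splitAt zero    f = ≈-sym (identityˡ _)
    sum-splitAt (suc m) f = ≈-trans (∙-congˡ (sum-splitAt m (f ∘ suc))) (≈-sym (assoc _ _ _))

    sum-combine : ∀ m {n} (f : Fin (m * n) → Carrier) →
                  sum f ≈ ∑[ i < m ] ∑[ j < n ] f (combine i j)
    sum-combine zero        f = ≈-refl
    sum-combine (suc m) {n} f = ≈-trans (sum-splitAt n f) (∙-congˡ (sum-combine m (f ∘ (n ↑ʳ_))))

  open import Algebra.Properties.CommutativeMonoid.Sum ℕ.+-0-commutativeMonoid public
    using (sum-syntax)
    renaming (sum to ∑ℕ; sum-cong-≗ to ∑ℕ-cong; sum-permute to ∑ℕ-permute; ∑-comm to ∑ℕ-comm)

  sumℕ≡∑ : ∀ {n} (f : Fin n → ℕ) → sumℕ f ≡ ∑ℕ f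
  sumℕ≡∑ {zero}  f = refl
  sumℕ≡∑ {suc n} f = cong (f zero +_) (sumℕ≡∑ (f ∘ suc))

  𝟙 : ∀ {P : Set} → Dec P → ℕ
  𝟙 (yes _) = 1
  𝟙 (no  _) = 0

  𝟙-yes : ∀ {P : Set} (P? : Dec P) → P → 𝟙 P? ≡ 1
  𝟙-yes (yes _) _ = refl
  𝟙-yes (no ¬p) p = contradiction p ¬p

  𝟙-no : ∀ {P : Set} (P? : Dec P) → ¬ P → 𝟙 P? ≡ 0
  𝟙-no (yes p) ¬p = contradiction p ¬p
  𝟙-no (no _)  _  = refl

  𝟙-cong : ∀ {P P′ : Set} (P? : Dec P) (P′? : Dec P′) → (P → P′) → (P′ → P) → 𝟙 P? ≡ 𝟙 P′?
  𝟙-cong (yes p) P′? f g = sym (𝟙-yes P′? (f p))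
  𝟙-cong (no ¬p) P′? f g = sym (𝟙-no P′? (¬p ∘ g))

  count≡∑ : ∀ {n} {P : Fin n → Set} (P? : ∀ i → Dec (P i)) → count P? ≡ ∑[ i < n ] 𝟙 (P? i)
  count≡∑ {zero}  P? = refl
  count≡∑ {suc n} P? with P? zero
  ... | yes _ = cong suc (count≡∑ (P? ∘ suc))
  ... | no  _ = count≡∑ (P? ∘ suc)

  count-cong : ∀ {n} {P P′ : Fin n → Set} (P? : ∀ i → Dec (P i)) (P′? : ∀ i → Dec (P′ i)) →
               (∀ i → P i → P′ i) → (∀ i → P′ i → P i) → count P? ≡ count P′?
  count-cong P? P′? f g = begin
    count P?                ≡⟨ count≡∑ P? ⟩
    (∑[ i < _ ] 𝟙 (P? i))   ≡⟨ ∑ℕ-cong (λ i → 𝟙-cong (P? i) (P′? i) (f i) (g i)) ⟩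
    (∑[ i < _ ] 𝟙 (P′? i))  ≡⟨ count≡∑ P′? ⟨
    count P′?               ∎
    where open ≡-Reasoning

  count-permute : ∀ {n} {P : Fin n → Set} (P? : ∀ i → Dec (P i)) (π : Permutation n n) →
                  count P? ≡ count (P? ∘ (π ⟨$⟩ʳ_))
  count-permute P? π = begin
    count P?                          ≡⟨ count≡∑ P? ⟩
    (∑[ i < _ ] 𝟙 (P? i))             ≡⟨ ∑ℕ-permute (𝟙 ∘ P?) π ⟩
    (∑[ i < _ ] 𝟙 (P? (π ⟨$⟩ʳ i)))    ≡⟨ count≡∑ (P? ∘ (π ⟨$⟩ʳ_)) ⟨
    count (P? ∘ (π ⟨$⟩ʳ_))            ∎
    where open ≡-Reasoning

  -- Double counting: for an index i with `P i`, the only c that contributes is `g i`. The family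
  -- `P′` is left abstract so that each fibre can be stated as a system of equations of its own.
  count-fibres : ∀ {n m} (g : Fin n → Fin m) {P : Fin n → Set} (P? : ∀ i → Dec (P i))
                 {P′ : Fin m → Fin n → Set} (P′? : ∀ c i → Dec (P′ c i)) →
                 (∀ {i} → P i → P′ (g i) i) → (∀ {c i} → P′ c i → P i × g i ≡ c) →
                 count P? ≡ ∑[ c < m ] count (P′? c)
  count-fibres {n} {m} g P? P′? f h = begin
    count P?                                ≡⟨ count≡∑ P? ⟩
    (∑[ i < n ] 𝟙 (P? i))                   ≡⟨ ∑ℕ-cong fibre ⟨
    (∑[ i < n ] ∑[ c < m ] 𝟙 (P′? c i))     ≡⟨ ∑ℕ-comm (λ i c → 𝟙 (P′? c i)) ⟩
    (∑[ c < m ] ∑[ i < n ] 𝟙 (P′? c i))     ≡⟨ ∑ℕ-cong (λ c → count≡∑ (P′? c)) ⟨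
    (∑[ c < m ] count (P′? c))              ∎
    where
      open ≡-Reasoning
      fibre : ∀ i → (∑[ c < m ] 𝟙 (P′? c i)) ≡ 𝟙 (P? i)
      fibre i = begin
        (∑[ c < m ] 𝟙 (P′? c i))  ≡⟨ sum-single ℕ.+-0-commutativeMonoid _ (g i)
                                       (λ c c≢gi → 𝟙-no (P′? c i) (λ p → c≢gi (sym (proj₂ (h p))))) ⟩
        𝟙 (P′? (g i) i)           ≡⟨ 𝟙-cong (P′? (g i) i) (P? i) (proj₁ ∘ h) f ⟩
        𝟙 (P? i)                  ∎

  count-all : ∀ {n} {P : Fin n → Set} (P? : ∀ i → Dec (P i)) → (∀ i → P i) → count P? ≡ n
  count-all {zero}  P? p = refl
  count-all {suc n} P? p with P? zero
  ... | yes _ = cong suc (count-all (P? ∘ suc) (p ∘ suc))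
  ... | no ¬p = contradiction (p zero) ¬p

  count-none : ∀ {n} {P : Fin n → Set} (P? : ∀ i → Dec (P i)) → (∀ i → ¬ P i) → count P? ≡ 0
  count-none {zero}  P? ¬p = refl
  count-none {suc n} P? ¬p with P? zero
  ... | yes p = contradiction p (¬p zero)
  ... | no _  = count-none (P? ∘ suc) (¬p ∘ suc)

  -- Turns a lower bound on a count into that many distinct witnesses, as needed for bounding a
  -- number of roots.
  select : ∀ {n} {P : Fin n → Set} (P? : ∀ i → Dec (P i)) → Fin (count P?) → Fin n
  select {suc n} P? i with P? zero
  select {suc n} P? zero    | yes _ = zero
  select {suc n} P? (suc i) | yes _ = suc (select (P? ∘ suc) i)
  select {suc n} P? i       | no  _ = suc (select (P? ∘ suc) i)

  select-sound : ∀ {n} {P : Fin n → Set} (P? : ∀ i → Dec (P i)) i → P (select P? i)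
  select-sound {suc n} P? i with P? zero
  select-sound {suc n} P? zero    | yes p = p
  select-sound {suc n} P? (suc i) | yes _ = select-sound (P? ∘ suc) i
  select-sound {suc n} P? i       | no  _ = select-sound (P? ∘ suc) i

  select-injective : ∀ {n} {P : Fin n → Set} (P? : ∀ i → Dec (P i)) → Injective _≡_ _≡_ (select P?)
  select-injective {suc n} P? {i} {j} eq with P? zero
  select-injective {suc n} P? {zero}  {zero}  eq | yes _ = refl
  select-injective {suc n} P? {suc i} {suc j} eq | yes _ =
    cong suc (select-injective (P? ∘ suc) (Fin.suc-injective eq))
  select-injective {suc n} P? {i}     {j}     eq | no  _ =
    select-injective (P? ∘ suc) (Fin.suc-injective eq)

  count-⊎ : ∀ {n} {A B C : Fin n → Set} (A? : ∀ i → Dec (A i)) (B? : ∀ i → Dec (B i))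
            (C? : ∀ i → Dec (C i)) → (∀ i → A i → B i ⊎ C i) → count A? ≤ count B? + count C?
  count-⊎ {zero}  A? B? C? f = z≤n
  count-⊎ {suc n} A? B? C? f
    with rec ← count-⊎ (A? ∘ suc) (B? ∘ suc) (C? ∘ suc) (f ∘ suc)
    with A? zero | B? zero | C? zero
  ... | no _  | no _  | no _  = rec
  ... | no _  | no _  | yes _ = ℕ.≤-trans rec (ℕ.+-monoʳ-≤ _ (ℕ.n≤1+n _))
  ... | no _  | yes _ | no _  = ℕ.≤-trans rec (ℕ.n≤1+n _)
  ... | no _  | yes _ | yes _ = ℕ.≤-trans rec (ℕ.+-mono-≤ (ℕ.n≤1+n _) (ℕ.n≤1+n _))
  ... | yes _ | yes _ | no _  = s≤s rec
  ... | yes _ | yes _ | yes _ = s≤s (ℕ.≤-trans rec (ℕ.+-monoʳ-≤ _ (ℕ.n≤1+n _)))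
  ... | yes _ | no _  | yes _ = ℕ.≤-trans (s≤s rec) (ℕ.≤-reflexive (sym (ℕ.+-suc _ _)))
  ... | yes a | no ¬b | no ¬c = contradiction (f zero a) [ ¬b , ¬c ]′

  count-witness : ∀ {n} {P : Fin n → Set} (P? : ∀ i → Dec (P i)) → count P? ≢ 0 → ∃ P
  count-witness P? c≢0 with count P? in eq
  ... | zero  = contradiction refl c≢0
  ... | suc _ = _ , select-sound P? (subst Fin (sym eq) zero)

  -- Pigeonhole: if y were missed, punching it out of the codomain would inject `Fin (suc n)` into
  -- `Fin n`.
  injective⇒surjective : ∀ {m n} → m ≡ n → (f : Fin m → Fin n) → Injective _≡_ _≡_ f → ∀ y → ∃ λ x → f x ≡ y
  injective⇒surjective {suc n} refl f inj y with Fin.any? (λ x → f x Fin.≟ y)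
  ... | yes hit = hit
  ... | no miss = contradiction (Fin.injective⇒≤ {f = g} g-inj) ℕ.1+n≰n
    where
      y≢f : ∀ x → y ≢ f x
      y≢f x eq = miss (x , sym eq)
      g : Fin (suc n) → Fin n
      g x = punchOut (y≢f x)
      g-inj : Injective _≡_ _≡_ g
      g-inj {i} {j} eq = inj (Fin.punchOut-injective (y≢f i) (y≢f j) eq)

  funToFin-cong : ∀ {m n} {f g : Fin m → Fin n} → f ≗ g → funToFin f ≡ funToFin g
  funToFin-cong {zero}  f≗g = refl
  funToFin-cong {suc m} f≗g = cong₂ combine (f≗g zero) (funToFin-cong (f≗g ∘ suc))

  prime∤! : ∀ {p} → Prime p → ∀ {k} → k < p → ¬ p ∣ k ℕ.!
  prime∤! pr {zero}  k<p d = ℕ.<⇒≱ (ℕ.nonTrivial⇒n>1 _ {{prime⇒nonTrivial pr}}) (∣⇒≤ d)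
  prime∤! pr {suc k} k<p d with euclidsLemma (suc k) (k ℕ.!) pr d
  ... | inj₁ p∣1+k = ℕ.<⇒≱ k<p (∣⇒≤ p∣1+k)
  ... | inj₂ p∣k!  = prime∤! pr (ℕ.<-trans (ℕ.n<1+n k) k<p) p∣k!

  -- p divides p! = C(p,k) · k! · (p-k)!, and by Euclid's lemma it divides neither factorial, since
  -- both arguments are below p.
  prime∣C : ∀ {p} → Prime p → ∀ {k} → 0 < k → k < p → p ∣ p C k
  prime∣C {suc p′} pr {suc k′} 0<k k<p
    with euclidsLemma (p C k) (k ℕ.! * (p ∸ k) ℕ.!) pr p∣
    where
      p = suc p′
      k = suc k′
      instance _ = ℕ._!*_!≢0 k (p ∸ k)
      C*≡! : (p C k) * (k ℕ.! * (p ∸ k) ℕ.!) ≡ p ℕ.!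
      C*≡! = trans (cong (_* (k ℕ.! * (p ∸ k) ℕ.!)) (nCk≡n!/k![n-k]! (ℕ.<⇒≤ k<p)))
                   (m/n*n≡m (k![n∸k]!∣n! (ℕ.<⇒≤ k<p)))
      p∣ : p ∣ (p C k) * (k ℕ.! * (p ∸ k) ℕ.!)
      p∣ = subst (p ∣_) (sym C*≡!) (m∣m*n (p′ ℕ.!))
  ... | inj₁ d = d
  ... | inj₂ d with euclidsLemma (suc k′ ℕ.!) _ pr d
  ...   | inj₁ d₁ = contradiction d₁ (prime∤! pr k<p)
  ...   | inj₂ d₂ = contradiction d₂ (prime∤! pr (s≤s (ℕ.m∸n≤m p′ k′)))

  1<^ : ∀ {b} → 1 < b → ∀ n → 1 < b ^ suc n
  1<^ {b} 1<b n = ℕ.<-≤-trans 1<b (ℕ.m≤m*n b (b ^ n) {{ℕ.m^n≢0 b n {{ℕ.>-nonZero (ℕ.<-trans (s≤s z≤n) 1<b)}}}})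

open Counting

-- Finite fields: the identity x^Q = x, the characteristic, the Frobenius map

module FieldTheory {Q : ℕ} (F : FiniteField Q) where
  open FiniteField F public using (0≢1; inverse; enumeration)

  commutativeRing : CommutativeRing 0ℓ 0ℓ
  commutativeRing = record { isCommutativeRing = FiniteField.isCommutativeRing F }

  open CommutativeRing commutativeRing public
    using ( Carrier; _+_; _*_; -_; _-_; 0#; 1#; +-assoc; +-comm; +-identityˡ; +-identityʳ
          ; -‿inverseˡ; -‿inverseʳ; *-assoc; *-comm; *-identityˡ; *-identityʳ; distribˡ; distribʳ
          ; zeroˡ; zeroʳ; ring; semiring; commutativeSemiring; +-commutativeMonoid; *-commutativeMonoid)
  open import Algebra.Properties.Ring ring public
    using (x∙y⁻¹≈ε⇒x≈y; +-cancelˡ; +-cancelʳ)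
  open import Algebra.Properties.CommutativeSemiring.Exp commutativeSemiring public
  open import Algebra.Properties.Semiring.Mult semiring public using ()
    renaming (_×_ to _·_; ×-homo-+ to ·-homo-+; ×-assoc-* to ·-assoc-*; ×1-homo-* to ·1-homo-*)
  open import Algebra.Properties.Semiring.Sum semiring public
    using (sum-replicate; ∑-distrib-+; sum-init-last; *-distribˡ-sum)
    renaming (sum to ∑; sum-cong-≗ to ∑-cong)
  open import Algebra.Solver.Ring.NaturalCoefficients.Default commutativeSemiring public
    using (solve; _:=_; _:+_; _:*_; con)
  open ≡-Reasoning

  enum : Fin Q → Carrier
  enum = Bijection.to enumeration

  index : Carrier → Fin Q
  index x = proj₁ (Bijection.surjective enumeration x)

  enum-index : ∀ x → enum (index x) ≡ x
  enum-index x = proj₂ (Bijection.surjective enumeration x) refl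

  enum-injective : Injective _≡_ _≡_ enum
  enum-injective = Bijection.injective enumeration

  index-enum : ∀ i → index (enum i) ≡ i
  index-enum i = enum-injective (enum-index (enum i))

  infix 4 _≟_
  _≟_ : (x y : Carrier) → Dec (x ≡ y)
  x ≟ y = map′ (λ eq → trans (sym (enum-index x)) (trans (cong enum eq) (enum-index y)))
               (cong index) (index x Fin.≟ index y)

  *-cancelˡ : ∀ x {y z} → x ≢ 0# → x * y ≡ x * z → y ≡ z
  *-cancelˡ x {y} {z} x≢0 xy≡xz with x′ , xx′≡1 ← inverse x x≢0 = begin
    y             ≡⟨ undo y ⟨
    x′ * (x * y)  ≡⟨ cong (x′ *_) xy≡xz ⟩
    x′ * (x * z)  ≡⟨ undo z ⟩
    z             ∎
    where
      undo : ∀ w → x′ * (x * w) ≡ w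
      undo w = begin
        x′ * (x * w)  ≡⟨ *-assoc x′ x w ⟨
        x′ * x * w    ≡⟨ cong (_* w) (trans (*-comm x′ x) xx′≡1) ⟩
        1# * w        ≡⟨ *-identityˡ w ⟩
        w             ∎

  x*y≡0⇒y≡0 : ∀ {x y} → x ≢ 0# → x * y ≡ 0# → y ≡ 0#
  x*y≡0⇒y≡0 {x} x≢0 xy≡0 = *-cancelˡ x x≢0 (trans xy≡0 (sym (zeroʳ x)))

  *-≢0 : ∀ {x y} → x ≢ 0# → y ≢ 0# → x * y ≢ 0#
  *-≢0 x≢0 y≢0 = y≢0 ∘ x*y≡0⇒y≡0 x≢0

  ^-≢0 : ∀ {x} n → x ≢ 0# → x ^ n ≢ 0#
  ^-≢0 zero    x≢0 = 0≢1 ∘ sym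
  ^-≢0 (suc n) x≢0 = *-≢0 x≢0 (^-≢0 n x≢0)

  y≡x+[y-x] : ∀ x y → y ≡ x + (y - x)
  y≡x+[y-x] x y = begin
    y              ≡⟨ +-identityʳ y ⟨
    y + 0#         ≡⟨ cong (y +_) (-‿inverseˡ x) ⟨
    y + (- x + x)  ≡⟨ +-assoc y (- x) x ⟨
    y - x + x      ≡⟨ +-comm (y - x) x ⟩
    x + (y - x)    ∎

  module _ (f g : Carrier → Carrier) (fg : ∀ x → f (g x) ≡ x) (gf : ∀ x → g (f x) ≡ x) where
    private
      relabel : (Carrier → Carrier) → Fin Q → Fin Q
      relabel h = index ∘ h ∘ enum

      relabel-inverse : ∀ (h k : Carrier → Carrier) → (∀ x → h (k x) ≡ x) →
                        ∀ i → relabel h (relabel k i) ≡ i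
      relabel-inverse h k hk i =
        trans (cong (index ∘ h) (enum-index _)) (trans (cong index (hk _)) (index-enum i))

      π : Permutation Q Q
      π = permutation (relabel f) (relabel g) (relabel-inverse f g fg) (relabel-inverse g f gf)

    module _ {a ℓ} (M : CommutativeMonoid a ℓ) where
      open CommutativeMonoid M using (_≈_) renaming (Carrier to A; trans to ≈-trans; reflexive to ≈-reflexive)
      open import Algebra.Properties.CommutativeMonoid.Sum M using (sum-permute; sum-cong-≗) renaming (sum to total)

      -- Reindexing over the whole field, for any commutative monoid: it serves additively with x ↦
      -- x + 1 and multiplicatively with x ↦ a x.
      sum-bijection : (h : Carrier → A) → total (h ∘ enum) ≈ total (h ∘ f ∘ enum)
      sum-bijection h = ≈-trans (sum-permute (h ∘ enum) π)
                                (≈-reflexive (sum-cong-≗ {Q} (λ i → cong h (enum-index (f (enum i))))))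

  -- The shift x ↦ x + 1 permutes the field, so the sum of all elements does not change when
  -- `Q · 1#` is added to it.
  Q·1≡0 : Q · 1# ≡ 0#
  Q·1≡0 = +-cancelˡ (∑ enum) _ _ (begin
    ∑ enum + Q · 1#           ≡⟨ cong (∑ enum +_) (sum-replicate Q) ⟨
    ∑ enum + ∑ {Q} (λ _ → 1#) ≡⟨ ∑-distrib-+ enum (λ _ → 1#) ⟨
    ∑ (λ i → enum i + 1#)     ≡⟨ sum-bijection (_+ 1#) (_- 1#) +- -+ +-commutativeMonoid id ⟨
    ∑ enum                    ≡⟨ +-identityʳ _ ⟨
    ∑ enum + 0#               ∎)
    where
      -+ : ∀ x → (x + 1#) - 1# ≡ x
      -+ x = trans (+-assoc x 1# (- 1#)) (trans (cong (x +_) (-‿inverseʳ 1#)) (+-identityʳ x))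
      +- : ∀ x → (x - 1#) + 1# ≡ x
      +- x = trans (+-assoc x (- 1#) 1#) (trans (cong (x +_) (-‿inverseˡ 1#)) (+-identityʳ x))

  open import Algebra.Properties.CommutativeMonoid.Sum *-commutativeMonoid using ()
    renaming (sum to ∏; sum-replicate to ∏-replicate; ∑-distrib-+ to ∏-distrib-*; sum-cong-≗ to ∏-cong)

  ∏-≢0 : ∀ {n} (f : Fin n → Carrier) → (∀ i → f i ≢ 0#) → ∏ f ≢ 0#
  ∏-≢0 {zero}  f f≢0 = 0≢1 ∘ sym
  ∏-≢0 {suc n} f f≢0 = *-≢0 (f≢0 zero) (∏-≢0 (f ∘ suc) (f≢0 ∘ suc))

  private
    ifZero : Carrier → Carrier → Carrier → Carrier
    ifZero x a b with x ≟ 0#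
    ... | yes _ = a
    ... | no  _ = b

    ifZero-yes : ∀ {x} → x ≡ 0# → ∀ a b → ifZero x a b ≡ a
    ifZero-yes {x} x≡0 a b with x ≟ 0#
    ... | yes _  = refl
    ... | no x≢0 = contradiction x≡0 x≢0

    ifZero-no : ∀ {x} → x ≢ 0# → ∀ a b → ifZero x a b ≡ b
    ifZero-no {x} x≢0 a b with x ≟ 0#
    ... | yes x≡0 = contradiction x≡0 x≢0
    ... | no _    = refl

  Q≢0 : Q ≢ 0
  Q≢0 refl with () ← index 0#

  0^ : ∀ {n} → n ≢ 0 → 0# ^ n ≡ 0#
  0^ {zero}  n≢0 = contradiction refl n≢0
  0^ {suc n} _   = zeroˡ (0# ^ n)

  -- Compare the product of all nonzero elements with that of their multiples by a; to keep all Q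
  -- factors, zero is replaced by 1 in the former product and contributes an extra a to the latter.
  x^Q≡x : ∀ a → a ^ Q ≡ a
  x^Q≡x a with a ≟ 0#
  ... | yes refl = 0^ Q≢0
  ... | no a≢0 = *-cancelˡ P P≢0 (begin
    P * a ^ Q                                   ≡⟨ *-comm P (a ^ Q) ⟩
    a ^ Q * P                                   ≡⟨ cong (_* P) (∏-replicate Q) ⟨
    ∏ {Q} (λ _ → a) * P                         ≡⟨ ∏-distrib-* (λ _ → a) (h ∘ enum) ⟨
    ∏ (λ i → a * h (enum i))                    ≡⟨ ∏-cong (scale ∘ enum) ⟨
    ∏ (λ i → h (a * enum i) * δ (enum i))       ≡⟨ ∏-distrib-* (λ i → h (a * enum i)) (δ ∘ enum) ⟩
    ∏ (λ i → h (a * enum i)) * ∏ (δ ∘ enum)     ≡⟨ cong₂ _*_ (sym (sum-bijection (a *_) (a′ *_) aa′ a′a *-commutativeMonoid h)) ∏δ ⟩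
    P * a                                       ∎)
    where
      h δ : Carrier → Carrier
      h x = ifZero x 1# x
      δ x = ifZero x a 1#
      P = ∏ (h ∘ enum)
      a′ = proj₁ (inverse a a≢0)
      aa′ : ∀ x → a * (a′ * x) ≡ x
      aa′ x = trans (sym (*-assoc a a′ x)) (trans (cong (_* x) (proj₂ (inverse a a≢0))) (*-identityˡ x))
      a′a : ∀ x → a′ * (a * x) ≡ x
      a′a x = *-cancelˡ a a≢0 (aa′ (a * x))
      P≢0 : P ≢ 0#
      P≢0 = ∏-≢0 _ (λ i → h≢0 (enum i))
        where
          h≢0 : ∀ x → h x ≢ 0#
          h≢0 x with x ≟ 0#
          ... | yes _  = 0≢1 ∘ sym
          ... | no x≢0 = x≢0
      scale : ∀ x → h (a * x) * δ x ≡ a * h x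
      scale x with x ≟ 0#
      ... | yes x≡0 = trans (cong (_* a) (ifZero-yes (trans (cong (a *_) x≡0) (zeroʳ a)) 1# (a * x))) (*-comm 1# a)
      ... | no x≢0  = trans (*-identityʳ _) (ifZero-no (*-≢0 a≢0 x≢0) 1# (a * x))
      ∏δ : ∏ (δ ∘ enum) ≡ a
      ∏δ = trans (sum-single *-commutativeMonoid (δ ∘ enum) (index 0#)
                    (λ i i≢ → ifZero-no (λ eq → i≢ (trans (sym (index-enum i)) (cong index eq))) a 1#))
                 (ifZero-yes (enum-index 0#) a 1#)

  ∣⇒·≡0 : ∀ {p n} → p · 1# ≡ 0# → p ∣ n → ∀ x → n · x ≡ 0#
  ∣⇒·≡0 {p} p·1≡0 (divides c refl) x = begin
    (c ℕ.* p) · x         ≡⟨ cong ((c ℕ.* p) ·_) (*-identityˡ x) ⟨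
    (c ℕ.* p) · (1# * x)  ≡⟨ ·-assoc-* (c ℕ.* p) 1# x ⟨
    (c ℕ.* p) · 1# * x    ≡⟨ cong (_* x) (·1-homo-* c p) ⟩
    c · 1# * p · 1# * x   ≡⟨ cong (λ z → c · 1# * z * x) p·1≡0 ⟩
    c · 1# * 0# * x       ≡⟨ cong (_* x) (zeroʳ _) ⟩
    0# * x                ≡⟨ zeroˡ x ⟩
    0#                    ∎

  ·1-homo-^ : ∀ m n → (m ℕ.^ n) · 1# ≡ (m · 1#) ^ n
  ·1-homo-^ m zero    = +-identityʳ 1#
  ·1-homo-^ m (suc n) = trans (·1-homo-* m (m ℕ.^ n)) (cong (m · 1# *_) (·1-homo-^ m n))

  -- (p·1)^k = p^k·1 = Q·1 = 0, and a field has no nilpotent elements other than 0.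
  characteristic : ∀ p k → Q ≡ p ℕ.^ k → p · 1# ≡ 0#
  characteristic p k refl with p · 1# ≟ 0#
  ... | yes p≡0 = p≡0
  ... | no p≢0  = contradiction (trans (sym (·1-homo-^ p k)) Q·1≡0) (^-≢0 k p≢0)

  AdditivePower : ℕ → Set
  AdditivePower n = ∀ x y → (x + y) ^ n ≡ x ^ n + y ^ n

  AdditivePower-^ : ∀ {n} → AdditivePower n → ∀ k → AdditivePower (n ℕ.^ k)
  AdditivePower-^ add zero    x y = trans (*-identityʳ _) (cong₂ _+_ (sym (*-identityʳ x)) (sym (*-identityʳ y)))
  AdditivePower-^ {n} add (suc k) x y = begin
    (x + y) ^ (n ℕ.* n ℕ.^ k)                  ≡⟨ ^-assocʳ (x + y) n (n ℕ.^ k) ⟨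
    ((x + y) ^ n) ^ (n ℕ.^ k)                  ≡⟨ cong (_^ (n ℕ.^ k)) (add x y) ⟩
    (x ^ n + y ^ n) ^ (n ℕ.^ k)                ≡⟨ AdditivePower-^ add k _ _ ⟩
    (x ^ n) ^ (n ℕ.^ k) + (y ^ n) ^ (n ℕ.^ k)  ≡⟨ cong₂ _+_ (^-assocʳ x n _) (^-assocʳ y n _) ⟩
    x ^ (n ℕ.* n ℕ.^ k) + y ^ (n ℕ.* n ℕ.^ k)  ∎

  -- In the binomial expansion every inner coefficient is a multiple of p; only the two end terms
  -- survive.
  frobenius : ∀ {p} → Prime p → p · 1# ≡ 0# → AdditivePower p
  frobenius {suc zero}    pr _ x y with () ← prime⇒nonTrivial pr
  frobenius {suc (suc n)} pr p·1≡0 x y = begin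
    (x + y) ^ p                                       ≡⟨ theorem p x y ⟩
    t zero + ∑ (t ∘ suc)                              ≡⟨ cong (t zero +_) (sum-init-last (t ∘ suc)) ⟩
    t zero + (∑ {suc n} (t ∘ suc ∘ inject₁) + t (Fin.fromℕ p))
      ≡⟨ cong (λ z → t zero + (z + t (Fin.fromℕ p))) (sum-zero +-commutativeMonoid _ middle) ⟩
    t zero + (0# + t (Fin.fromℕ p))                   ≡⟨ cong₂ _+_ first (trans (+-identityˡ _) last) ⟩
    y ^ p + x ^ p                                     ≡⟨ +-comm _ _ ⟩
    x ^ p + y ^ p                                     ∎
    where
      open import Algebra.Properties.CommutativeSemiring.Binomial commutativeSemiring using (theorem; binomialTerm)
      p = suc (suc n)
      t = binomialTerm x y p
      first : t zero ≡ y ^ p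
      first = trans (+-identityʳ _) (*-identityˡ _)
      last : t (Fin.fromℕ p) ≡ x ^ p
      last rewrite Fin.toℕ-fromℕ n | nCn≡1 p | ℕ.n∸n≡0 n = trans (+-identityʳ _) (*-identityʳ _)
      middle : ∀ i → t (suc (inject₁ i)) ≡ 0#
      middle i = ∣⇒·≡0 p·1≡0 (prime∣C pr (s≤s z≤n)
        (s≤s (subst (_< suc n) (sym (Fin.toℕ-inject₁ i)) (Fin.toℕ<n i)))) _

-- Polynomials as coefficient vectors: root bounds, fixed points of power maps, power bases

module Polynomials {Q : ℕ} (F : FiniteField Q) where
  open FieldTheory F
  open ≡-Reasoning

  ev : ∀ {n} → (Fin n → Carrier) → Carrier → Carrier
  ev {zero}  a x = 0#
  ev {suc n} a x = a zero + x * ev (a ∘ suc) x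

  ev-cong : ∀ {n} {a b : Fin n → Carrier} → a ≗ b → ∀ x → ev a x ≡ ev b x
  ev-cong {zero}  a≗b x = refl
  ev-cong {suc n} a≗b x = cong₂ (λ y z → y + x * z) (a≗b zero) (ev-cong (a≗b ∘ suc) x)

  ev-zero : ∀ {n} {a : Fin n → Carrier} → (∀ i → a i ≡ 0#) → ∀ x → ev a x ≡ 0#
  ev-zero {zero}  a≡0 x = refl
  ev-zero {suc n} a≡0 x =
    trans (cong₂ (λ y z → y + x * z) (a≡0 zero) (ev-zero (a≡0 ∘ suc) x))
          (trans (+-identityˡ _) (zeroʳ x))

  ev-const : ∀ {n} (a : Fin (suc n) → Carrier) → (∀ i → a (suc i) ≡ 0#) → ∀ x → ev a x ≡ a zero
  ev-const a a≡0 x =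
    trans (cong (λ y → a zero + x * y) (ev-zero a≡0 x)) (trans (cong (a zero +_) (zeroʳ x)) (+-identityʳ _))

  ev-+ : ∀ {n} (a b : Fin n → Carrier) x → ev (λ i → a i + b i) x ≡ ev a x + ev b x
  ev-+ {zero}  a b x = sym (+-identityˡ 0#)
  ev-+ {suc n} a b x = trans (cong (λ y → a zero + b zero + x * y) (ev-+ (a ∘ suc) (b ∘ suc) x))
    (solve 5 (λ a₀ b₀ x y z → a₀ :+ b₀ :+ x :* (y :+ z) := a₀ :+ x :* y :+ (b₀ :+ x :* z)) refl
      (a zero) (b zero) x (ev (a ∘ suc) x) (ev (b ∘ suc) x))

  ev-* : ∀ {n} c (a : Fin n → Carrier) x → ev (λ i → c * a i) x ≡ c * ev a x
  ev-* {zero}  c a x = sym (zeroʳ c)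
  ev-* {suc n} c a x = trans (cong (λ y → c * a zero + x * y) (ev-* c (a ∘ suc) x))
    (solve 4 (λ c a₀ x y → c :* a₀ :+ x :* (c :* y) := c :* (a₀ :+ x :* y)) refl
      c (a zero) x (ev (a ∘ suc) x))

  ev-difference : ∀ {n} (a b : Fin n → Carrier) {x} → ev a x ≡ ev b x → ev (λ i → a i - b i) x ≡ 0#
  ev-difference a b {x} eq = +-cancelˡ (ev b x) _ _ (begin
    ev b x + ev (λ i → a i - b i) x   ≡⟨ ev-+ b _ x ⟨
    ev (λ i → b i + (a i - b i)) x    ≡⟨ ev-cong (λ i → sym (y≡x+[y-x] (b i) (a i))) x ⟩
    ev a x                            ≡⟨ eq ⟩
    ev b x                            ≡⟨ +-identityʳ _ ⟨
    ev b x + 0#                       ∎)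

  -- The n-th power map is then multiplicative, additive and trivial on the coefficients, so it
  -- commutes with Horner evaluation. In particular it sends roots to roots.
  ev-^ : ∀ {n} → n ≢ 0 → AdditivePower n → ∀ {m} (a : Fin m → Carrier) → (∀ i → a i ^ n ≡ a i) →
         ∀ x → ev a x ^ n ≡ ev a (x ^ n)
  ev-^ n≢0 add {zero}  a fix x = 0^ n≢0
  ev-^ {n} n≢0 add {suc m} a fix x = begin
    (a zero + x * ev (a ∘ suc) x) ^ n          ≡⟨ add _ _ ⟩
    a zero ^ n + (x * ev (a ∘ suc) x) ^ n      ≡⟨ cong₂ _+_ (fix zero) (^-distrib-* x _ n) ⟩
    a zero + x ^ n * ev (a ∘ suc) x ^ n        ≡⟨ cong (λ y → a zero + x ^ n * y) (ev-^ n≢0 add (a ∘ suc) (fix ∘ suc) x) ⟩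
    a zero + x ^ n * ev (a ∘ suc) (x ^ n)      ∎

  -- Synthetic division: the coefficients of (a(x) - a(c)) / (x - c) are the Horner values at c of
  -- the successive tails of a.
  quotient : ∀ {n} → (Fin (suc n) → Carrier) → Carrier → Fin n → Carrier
  quotient {suc n} a c zero    = ev (a ∘ suc) c
  quotient {suc n} a c (suc i) = quotient (a ∘ suc) c i

  -- Division by x − c, with x written as c + δ so that no subtraction occurs.
  ev-quotient : ∀ {n} (a : Fin (suc n) → Carrier) c δ →
                ev a (c + δ) ≡ ev a c + δ * ev (quotient a c) (c + δ)
  ev-quotient {zero}  a c δ =
    solve 3 (λ a₀ c δ → a₀ :+ (c :+ δ) :* con 0 := a₀ :+ c :* con 0 :+ δ :* con 0) refl (a zero) c δ
  ev-quotient {suc n} a c δ = trans (cong (λ y → a zero + (c + δ) * y) (ev-quotient (a ∘ suc) c δ))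
    (solve 5 (λ a₀ c δ e r → a₀ :+ (c :+ δ) :* (e :+ δ :* r) := a₀ :+ c :* e :+ δ :* (e :+ (c :+ δ) :* r)) refl
      (a zero) c δ (ev (a ∘ suc) c) (ev (quotient (a ∘ suc) c) (c + δ)))

  -- Works down from the top: once all higher coefficients vanish, the tail is constant, and its
  -- value at c, a coefficient of the quotient, is its lowest coefficient.
  quotient-zero : ∀ {n} (a : Fin (suc n) → Carrier) c →
                  (∀ i → quotient a c i ≡ 0#) → ∀ i → a (suc i) ≡ 0#
  quotient-zero {suc n} a c q≡0 zero    =
    trans (sym (ev-const (a ∘ suc) (quotient-zero (a ∘ suc) c (q≡0 ∘ suc)) c)) (q≡0 zero)
  quotient-zero {suc n} a c q≡0 (suc i) = quotient-zero (a ∘ suc) c (q≡0 ∘ suc) i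

  -- Divide by x - c at the first root c. Every other root differs from c, so it is a root of the
  -- quotient, which has one coefficient and one prescribed root fewer.
  root-bound : ∀ {n} (a xs : Fin n → Carrier) → Injective _≡_ _≡_ xs →
               (∀ i → ev a (xs i) ≡ 0#) → ∀ i → a i ≡ 0#
  root-bound {suc n} a xs inj root = vanish
    where
      c = xs zero
      tail-root : ∀ i → ev (quotient a c) (xs (suc i)) ≡ 0#
      tail-root i = x*y≡0⇒y≡0 δ≢0 (begin
        δ * ev (quotient a c) x              ≡⟨ +-identityˡ _ ⟨
        0# + δ * ev (quotient a c) x         ≡⟨ cong₂ (λ y z → y + δ * ev (quotient a c) z) (sym (root zero)) x≡c+δ ⟩
        ev a c + δ * ev (quotient a c) (c + δ)  ≡⟨ ev-quotient a c δ ⟨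
        ev a (c + δ)                         ≡⟨ cong (ev a) x≡c+δ ⟨
        ev a x                               ≡⟨ root (suc i) ⟩
        0#                                   ∎)
        where
          x = xs (suc i)
          δ = x - c
          x≡c+δ = y≡x+[y-x] c x
          δ≢0 : δ ≢ 0#
          δ≢0 δ≡0 with () ← inj (x∙y⁻¹≈ε⇒x≈y x c δ≡0)
      tail-zero : ∀ i → a (suc i) ≡ 0#
      tail-zero = quotient-zero a c (root-bound (quotient a c) (xs ∘ suc) (Fin.suc-injective ∘ inj) tail-root)
      vanish : ∀ i → a i ≡ 0#
      vanish zero    = trans (sym (ev-const a tail-zero c)) (root zero)
      vanish (suc i) = tail-zero i

  monic : ∀ {n} → (Fin n → Carrier) → Fin (suc n) → Carrier
  monic {zero}  a _       = 1#
  monic {suc n} a zero    = a zero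
  monic {suc n} a (suc i) = monic (a ∘ suc) i

  ev-monic : ∀ {n} (a : Fin n → Carrier) x → ev (monic a) x ≡ ev a x + x ^ n
  ev-monic {zero}  a x = solve 1 (λ x → con 1 :+ x :* con 0 := con 0 :+ con 1) refl x
  ev-monic {suc n} a x = trans (cong (λ y → a zero + x * y) (ev-monic (a ∘ suc) x))
    (solve 4 (λ a₀ x y z → a₀ :+ x :* (y :+ z) := a₀ :+ x :* y :+ x :* z) refl (a zero) x (ev (a ∘ suc) x) (x ^ n))

  monic-top : ∀ {n} (a : Fin n → Carrier) → monic a (Fin.fromℕ n) ≡ 1#
  monic-top {zero}  a = refl
  monic-top {suc n} a = monic-top (a ∘ suc)

  monic-root-bound : ∀ {n} (a : Fin n → Carrier) (xs : Fin (suc n) → Carrier) → Injective _≡_ _≡_ xs →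
                     ¬ (∀ i → ev a (xs i) + xs i ^ n ≡ 0#)
  monic-root-bound {n} a xs inj root = 0≢1 (trans
    (sym (root-bound (monic a) xs inj (λ i → trans (ev-monic a (xs i)) (root i)) (Fin.fromℕ n)))
    (monic-top a))

  fixed? : ∀ n i → Dec (enum i ^ n ≡ enum i)
  fixed? n i = enum i ^ n ≟ enum i

  -- The fixed points are the roots of x^n - x, which is monic of degree n because n ≥ 2 keeps the
  -- two terms apart.
  count-fixed : ∀ {n} → 1 < n → count (fixed? n) ≤ n
  count-fixed {suc zero}      (s≤s ())
  count-fixed {N@(suc (suc n))} _ = ℕ.≮⇒≥ λ N<count →
    monic-root-bound a (enum ∘ select (fixed? N) ∘ (λ i → inject≤ i N<count))
      (Fin.inject≤-injective N<count N<count _ _ ∘ select-injective (fixed? N) ∘ enum-injective)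
      (λ i → root _ (select-sound (fixed? N) (inject≤ i N<count)))
    where
      a : Fin N → Carrier
      a zero          = 0#
      a (suc zero)    = - 1#
      a (suc (suc _)) = 0#
      root : ∀ x → x ^ N ≡ x → ev a x + x ^ N ≡ 0#
      root x x^N≡x = begin
        0# + x * ev (a ∘ suc) x + x ^ N  ≡⟨ cong₂ _+_ (trans (+-identityˡ _) (cong (x *_) (ev-const (a ∘ suc) (λ _ → refl) x))) x^N≡x ⟩
        x * - 1# + x                     ≡⟨ cong (x * - 1# +_) (*-identityʳ x) ⟨
        x * - 1# + x * 1#                ≡⟨ distribˡ x (- 1#) 1# ⟨
        x * (- 1# + 1#)                  ≡⟨ cong (x *_) (-‿inverseˡ 1#) ⟩
        x * 0#                           ≡⟨ zeroʳ x ⟩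
        0#                               ∎

  -- Additivity is applied to y + (x - y), which avoids any discussion of the sign (-1)^n.
  fixed-difference : ∀ n → AdditivePower n → ∀ {x y} → x ^ n ≡ x → y ^ n ≡ y → (x - y) ^ n ≡ x - y
  fixed-difference n add {x} {y} x-fix y-fix = +-cancelˡ y _ _ (begin
    y + (x - y) ^ n      ≡⟨ cong (_+ (x - y) ^ n) y-fix ⟨
    y ^ n + (x - y) ^ n  ≡⟨ add y (x - y) ⟨
    (y + (x - y)) ^ n    ≡⟨ cong (_^ n) (y≡x+[y-x] y x) ⟨
    x ^ n                ≡⟨ x-fix ⟩
    x                    ≡⟨ y≡x+[y-x] y x ⟩
    y + (x - y)          ∎)

  fixed-^ : ∀ {n x} → x ^ n ≡ x → ∀ k → x ^ (n ℕ.^ k) ≡ x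
  fixed-^ fix zero    = *-identityʳ _
  fixed-^ {n} {x} fix (suc k) =
    trans (sym (^-assocʳ x n (n ℕ.^ k))) (trans (cong (_^ (n ℕ.^ k)) fix) (fixed-^ fix k))

  -- Fewer than q^r elements satisfy x^(q^j) = x for some 0 < j < r. Any other element γ has r distinct
  -- conjugates γ^(q^j), so no nonzero polynomial of degree < r fixed by the q-power map vanishes at γ.
  module PowerBasis {q r′ : ℕ} (Q≡q^r : Q ≡ q ℕ.^ suc r′) (1<q : 1 < q) (add : AdditivePower q) where
    r = suc r′

    -- x has a Frobenius orbit of period j for some 1 ≤ j ≤ n. The nested disjunction lets `count-⊎`
    -- bound the number of such x one exponent at a time.
    Short : ℕ → Carrier → Set
    Short zero    x = ⊥
    Short (suc n) x = Short n x ⊎ x ^ (q ℕ.^ suc n) ≡ x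

    short? : ∀ n x → Dec (Short n x)
    short? zero    x = no id
    short? (suc n) x = short? n x ⊎-dec (x ^ (q ℕ.^ suc n) ≟ x)

    short : ∀ {n j x} → j < n → x ^ (q ℕ.^ suc j) ≡ x → Short n x
    short {suc n} {j} j<n eq with j ℕ.≟ n
    ... | yes refl = inj₂ eq
    ... | no j≢n   = inj₁ (short (ℕ.≤∧≢⇒< (ℕ.≤-pred j<n) j≢n) eq)

    -- At most q^j elements are fixed by the q^j-power map, and q + ... + q^n < q^(n+1) as 2 ≤ q.
    -- The induction uses q^(n+1) + q^(n+1) ≤ q · q^(n+1).
    count-short : ∀ n → count (short? n ∘ enum) < q ℕ.^ suc n
    count-short zero    = ℕ.≤-<-trans (ℕ.≤-reflexive (count-none (short? 0 ∘ enum) (λ _ → id)))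
                                      (ℕ.<-trans (s≤s z≤n) (1<^ 1<q 0))
    count-short (suc n) = ℕ.≤-<-trans
      (count-⊎ (short? (suc n) ∘ enum) (short? n ∘ enum) (fixed? (q ℕ.^ suc n)) (λ _ → id))
      (ℕ.<-≤-trans (ℕ.+-mono-<-≤ (count-short n) (count-fixed (1<^ 1<q n)))
        (ℕ.≤-trans (ℕ.≤-reflexive (cong (q ℕ.^ suc n ℕ.+_) (sym (ℕ.+-identityʳ _))))
                   (ℕ.*-monoˡ-≤ (q ℕ.^ suc n) 1<q)))

    abstract
      generator : ∃ λ i → ¬ Short r′ (enum i)
      generator with Fin.any? (λ i → ¬? (short? r′ (enum i)))
      ... | yes γ = γ
      ... | no none = contradiction (count-short r′) (ℕ.≤⇒≯ (ℕ.≤-reflexive (trans (sym Q≡q^r)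
              (sym (count-all (short? r′ ∘ enum) (λ i → decidable-stable (short? r′ (enum i)) (λ ¬s → none (i , ¬s))))))))

    γ : Carrier
    γ = enum (proj₁ generator)

    -- Raising a coincidence to the power q^(r-i) completes the first i Frobenius steps to a full
    -- turn, since γ^(q^r) = γ. What remains is γ = γ^(q^(d+1)), contrary to the choice of γ.
    conjugate-distinct : ∀ i d → i ℕ.+ suc d < r → γ ^ (q ℕ.^ i) ≢ γ ^ (q ℕ.^ (i ℕ.+ suc d))
    conjugate-distinct i d j<r eq = proj₂ generator (short {j = d} d<r′ (sym (begin
      γ                                            ≡⟨ γ^q^r ⟨
      γ ^ (q ℕ.^ r)                                ≡⟨ cong (λ n → γ ^ (q ℕ.^ n)) i+ρ≡r ⟨
      γ ^ (q ℕ.^ (i ℕ.+ ρ))                        ≡⟨ raise i ⟨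
      (γ ^ (q ℕ.^ i)) ^ (q ℕ.^ ρ)                  ≡⟨ cong (_^ (q ℕ.^ ρ)) eq ⟩
      (γ ^ (q ℕ.^ (i ℕ.+ suc d))) ^ (q ℕ.^ ρ)      ≡⟨ raise (i ℕ.+ suc d) ⟩
      γ ^ (q ℕ.^ (i ℕ.+ suc d ℕ.+ ρ))              ≡⟨ cong (λ n → γ ^ (q ℕ.^ n)) exponent ⟩
      γ ^ (q ℕ.^ (r ℕ.+ suc d))                    ≡⟨ raise′ r (suc d) ⟨
      (γ ^ (q ℕ.^ r)) ^ (q ℕ.^ suc d)              ≡⟨ cong (_^ (q ℕ.^ suc d)) γ^q^r ⟩
      γ ^ (q ℕ.^ suc d)                            ∎)))
      where
        ρ = r ∸ i
        γ^q^r : γ ^ (q ℕ.^ r) ≡ γ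
        γ^q^r = subst (λ n → γ ^ n ≡ γ) Q≡q^r (x^Q≡x γ)
        i+ρ≡r : i ℕ.+ ρ ≡ r
        i+ρ≡r = ℕ.m+[n∸m]≡n (ℕ.<⇒≤ (ℕ.≤-<-trans (ℕ.m≤m+n i (suc d)) j<r))
        raise′ : ∀ n k → (γ ^ (q ℕ.^ n)) ^ (q ℕ.^ k) ≡ γ ^ (q ℕ.^ (n ℕ.+ k))
        raise′ n k = trans (^-assocʳ γ (q ℕ.^ n) (q ℕ.^ k)) (cong (γ ^_) (sym (ℕ.^-distribˡ-+-* q n k)))
        raise : ∀ n → (γ ^ (q ℕ.^ n)) ^ (q ℕ.^ ρ) ≡ γ ^ (q ℕ.^ (n ℕ.+ ρ))
        raise n = raise′ n ρ
        exponent : i ℕ.+ suc d ℕ.+ ρ ≡ r ℕ.+ suc d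
        exponent = trans (ℕ.+-assoc i (suc d) ρ) (trans (cong (i ℕ.+_) (ℕ.+-comm (suc d) ρ))
                     (trans (sym (ℕ.+-assoc i ρ (suc d))) (cong (ℕ._+ suc d) i+ρ≡r)))
        d<r′ : d < r′
        d<r′ = ℕ.≤-pred (ℕ.≤-<-trans (ℕ.m≤n+m (suc d) i) j<r)

    conjugate : Fin r → Carrier
    conjugate i = γ ^ (q ℕ.^ toℕ i)

    conjugate-< : ∀ i j → toℕ i < toℕ j → conjugate i ≢ conjugate j
    conjugate-< i j i<j eq = conjugate-distinct (toℕ i) (toℕ j ∸ suc (toℕ i))
      (subst (_< r) (sym j≡) (Fin.toℕ<n j)) (trans eq (cong (λ n → γ ^ (q ℕ.^ n)) (sym j≡)))
      where
        j≡ : toℕ i ℕ.+ suc (toℕ j ∸ suc (toℕ i)) ≡ toℕ j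
        j≡ = trans (ℕ.+-suc (toℕ i) _) (ℕ.m+[n∸m]≡n i<j)

    conjugate-injective : Injective _≡_ _≡_ conjugate
    conjugate-injective {i} {j} eq with ℕ.<-cmp (toℕ i) (toℕ j)
    ... | tri< i<j _ _ = contradiction eq (conjugate-< i j i<j)
    ... | tri≈ _ i≡j _ = Fin.toℕ-injective i≡j
    ... | tri> _ _ j<i = contradiction (sym eq) (conjugate-< j i j<i)

    independent : (w : Fin r → Carrier) → (∀ i → w i ^ q ≡ w i) → ev w γ ≡ 0# → ∀ i → w i ≡ 0#
    independent w fix w[γ]≡0 = root-bound w conjugate conjugate-injective λ i → begin
      ev w (conjugate i)           ≡⟨ ev-^ (q^≢0 (toℕ i)) (AdditivePower-^ add (toℕ i)) w (λ j → fixed-^ (fix j) (toℕ i)) γ ⟨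
      ev w γ ^ (q ℕ.^ toℕ i)       ≡⟨ cong (_^ (q ℕ.^ toℕ i)) w[γ]≡0 ⟩
      0# ^ (q ℕ.^ toℕ i)           ≡⟨ 0^ (q^≢0 (toℕ i)) ⟩
      0#                           ∎
      where
        q^≢0 : ∀ n → q ℕ.^ n ≢ 0
        q^≢0 n = ℕ.≢-nonZero⁻¹ _ {{ℕ.m^n≢0 q n {{ℕ.>-nonZero (ℕ.<-trans (s≤s z≤n) 1<q)}}}}

    unique : (a b : Fin r → Carrier) → (∀ i → a i ^ q ≡ a i) → (∀ i → b i ^ q ≡ b i) →
             ev a γ ≡ ev b γ → a ≗ b
    unique a b a-fix b-fix eq i = x∙y⁻¹≈ε⇒x≈y (a i) (b i)
      (independent (λ i → a i - b i) (λ i → fixed-difference q add (a-fix i) (b-fix i)) (ev-difference a b eq) i)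

    module _ (ι : Fin q → Carrier) (ι-injective : Injective _≡_ _≡_ ι) (ι-fixed : ∀ i → ι i ^ q ≡ ι i) where
      abstract
        -- By `unique` the q^r combinations have distinct values, and the field has just q^r
        -- elements. For ι the multiples of 1 are used in F, and the image of φ in E.
        spanning : ∀ x → ∃ λ (c : Fin r → Fin q) → ev (ι ∘ c) γ ≡ x
        spanning x = decode (proj₁ hit) , trans (sym (enum-index _)) (trans (cong enum (proj₂ hit)) (enum-index x))
          where
            decode : Fin (q ℕ.^ r) → Fin r → Fin q
            decode = finToFun
            value : Fin (q ℕ.^ r) → Carrier
            value k = ev (ι ∘ decode k) γ
            value-injective : Injective _≡_ _≡_ (index ∘ value)
            value-injective {k} {l} eq = begin
              k                    ≡⟨ Fin.funToFin-finToFin {r} {q} k ⟨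
              funToFin (decode k)  ≡⟨ funToFin-cong (λ i → ι-injective (unique (ι ∘ decode k) (ι ∘ decode l) (λ i → ι-fixed (decode k i)) (λ i → ι-fixed (decode l i))
                                        (trans (sym (enum-index _)) (trans (cong enum eq) (enum-index _))) i)) ⟩
              funToFin (decode l)  ≡⟨ Fin.funToFin-finToFin {r} {q} l ⟩
              l                    ∎
            hit : ∃ λ k → index (value k) ≡ index x
            hit = injective⇒surjective (sym Q≡q^r) (index ∘ value) value-injective (index x)

-- The prime field as multiples of 1, and polynomials with coefficients in ℕ

module PrimeField {Q : ℕ} (F : FiniteField Q) where
  open FieldTheory F
  open Polynomials F
  open ≡-Reasoning

  1^ : ∀ n → 1# ^ n ≡ 1#
  1^ zero    = refl
  1^ (suc n) = trans (*-identityˡ _) (1^ n)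

  ·1-fixed : ∀ {n} → n ≢ 0 → AdditivePower n → ∀ m → (m · 1#) ^ n ≡ m · 1#
  ·1-fixed n≢0 add zero    = 0^ n≢0
  ·1-fixed {n} n≢0 add (suc m) = trans (add 1# (m · 1#)) (cong₂ _+_ (1^ n) (·1-fixed n≢0 add m))

  -- The coefficients belong to no particular field, so one vector can be evaluated at a point of F
  -- and at a point of E.
  evℕ : ∀ {n} → (Fin n → ℕ) → Carrier → Carrier
  evℕ a = ev (λ i → a i · 1#)

  evℕ-+ : ∀ {n} (a b : Fin n → ℕ) x → evℕ (λ i → a i ℕ.+ b i) x ≡ evℕ a x + evℕ b x
  evℕ-+ a b x = trans (ev-cong (λ i → ·-homo-+ 1# (a i) (b i)) x) (ev-+ (λ i → a i · 1#) (λ i → b i · 1#) x)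

  evℕ-* : ∀ {n} c (a : Fin n → ℕ) x → evℕ (λ i → c ℕ.* a i) x ≡ c · 1# * evℕ a x
  evℕ-* c a x = trans (ev-cong (λ i → ·1-homo-* c (a i)) x) (ev-* (c · 1#) (λ i → a i · 1#) x)

  ev-init-last : ∀ {n} (a : Fin (suc n) → Carrier) x →
                 ev a x ≡ ev (a ∘ inject₁) x + a (Fin.fromℕ n) * x ^ n
  ev-init-last {zero}  a x = solve 2 (λ a₀ x → a₀ :+ x :* con 0 := con 0 :+ a₀ :* con 1) refl (a zero) x
  ev-init-last {suc n} a x = trans (cong (λ y → a zero + x * y) (ev-init-last (a ∘ suc) x))
    (solve 5 (λ a₀ x y t z → a₀ :+ x :* (y :+ t :* z) := a₀ :+ x :* y :+ t :* (x :* z)) refl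
      (a zero) x (ev (a ∘ suc ∘ inject₁) x) (a (Fin.fromℕ (suc n))) (x ^ n))

  module _ {p : ℕ} (p-prime : Prime p) (p·1≡0 : p · 1# ≡ 0#) where
    private
      instance _ = prime⇒nonZero p-prime

      multiple≡0 : ∀ m {n} → n · 1# ≡ 0# → (m ℕ.* n) · 1# ≡ 0#
      multiple≡0 m {n} n·1≡0 = trans (·1-homo-* m n) (trans (cong (m · 1# *_) n·1≡0) (zeroʳ _))

      bézout≡ : ∀ {a b} → 1 ℕ.+ a ≡ b → a · 1# ≡ 0# → b · 1# ≡ 0# → ⊥
      bézout≡ refl a≡0 b≡0 = 0≢1 (trans (sym b≡0) (trans (cong (1# +_) a≡0) (+-identityʳ 1#)))

      -- n is coprime to p, so a Bézout identity writes 1 as a difference of multiples of n and p;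
      -- if both vanished in the field, then 1 = 0.
      ·1≢0 : ∀ {n} → 0 < n → n < p → n · 1# ≢ 0#
      ·1≢0 {n} 0<n n<p n≡0 with coprime-Bézout (prime⇒coprime p-prime {{ℕ.>-nonZero 0<n}} n<p)
      ... | Bézout.+- x y eq = bézout≡ eq (multiple≡0 y n≡0) (multiple≡0 x p·1≡0)
      ... | Bézout.-+ x y eq = bézout≡ eq (multiple≡0 x p·1≡0) (multiple≡0 y n≡0)

      ·1-< : ∀ {m n} → m < n → n < p → m · 1# ≢ n · 1#
      ·1-< {m} {n} m<n n<p eq = ·1≢0 (ℕ.m<n⇒0<n∸m m<n) (ℕ.≤-<-trans (ℕ.m∸n≤m n m) n<p)
        (+-cancelˡ (m · 1#) _ _ (begin
          m · 1# + (n ∸ m) · 1#  ≡⟨ ·-homo-+ 1# m (n ∸ m) ⟨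
          (m ℕ.+ (n ∸ m)) · 1#   ≡⟨ cong (_· 1#) (ℕ.m+[n∸m]≡n (ℕ.<⇒≤ m<n)) ⟩
          n · 1#                 ≡⟨ eq ⟨
          m · 1#                 ≡⟨ +-identityʳ _ ⟨
          m · 1# + 0#            ∎))

    ·1-injective : ∀ {m n} → m < p → n < p → m · 1# ≡ n · 1# → m ≡ n
    ·1-injective {m} {n} m<p n<p eq with ℕ.<-cmp m n
    ... | tri< m<n _ _ = contradiction eq (·1-< m<n n<p)
    ... | tri≈ _ m≡n _ = m≡n
    ... | tri> _ _ n<m = contradiction (sym eq) (·1-< n<m m<p)

    ·1-% : ∀ m → m · 1# ≡ (m % p) · 1#
    ·1-% m = begin
      m · 1#                                ≡⟨ cong (_· 1#) (m≡m%n+[m/n]*n m p) ⟩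
      (m % p ℕ.+ m / p ℕ.* p) · 1#          ≡⟨ ·-homo-+ 1# (m % p) _ ⟩
      (m % p) · 1# + (m / p ℕ.* p) · 1#     ≡⟨ cong ((m % p) · 1# +_) (multiple≡0 (m / p) p·1≡0) ⟩
      (m % p) · 1# + 0#                     ≡⟨ +-identityʳ _ ⟩
      (m % p) · 1#                          ∎

-- Division of powers of x by x^k - d(x), with coefficients in ℕ

module Reduction {k′ : ℕ} (d : Fin (suc k′) → ℕ) where
  k = suc k′

  top : (Fin k → ℕ) → ℕ
  top a = a (Fin.fromℕ k′)

  -- Multiplication by x in ℕ[x], reduced by the rule x^k = d(x).
  x· : (Fin k → ℕ) → Fin k → ℕ
  x· a zero    = top a ℕ.* d zero
  x· a (suc i) = a (inject₁ i) ℕ.+ top a ℕ.* d (suc i)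

  -- The residue of x^(k+n), not of x^n: the sequence starts with d, the residue of x^k.
  remainder : ℕ → Fin k → ℕ
  remainder zero    = d
  remainder (suc n) = x· (remainder n)

  -- The quotient of x^(k+n) by x^k - d(x) without its leading term x^n. Each step multiplies the
  -- old quotient by x and puts in the leading coefficient that `x·` has just reduced.
  cofactor : ∀ n → Fin n → ℕ
  cofactor (suc n) zero    = top (remainder n)
  cofactor (suc n) (suc i) = cofactor n i

  module _ {Q : ℕ} (F : FiniteField Q) where
    open FieldTheory F
    open Polynomials F
    open PrimeField F
    open ≡-Reasoning

    module _ {x δ : Carrier} (x^k : x ^ k ≡ evℕ d x + δ) where

      -- The leading term t x^k of x·a(x) equals t(d(x) + δ), and `x·` keeps t d(x) only. The error
      -- δ is arbitrary: it is 0 at α and β, and the value of x^k - d(x) at a general point. Adding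
      -- `t * D` to both sides keeps the computation inside the semiring.
      evℕ-x· : ∀ a → evℕ (x· a) x + top a · 1# * δ ≡ x * evℕ a x
      evℕ-x· a = +-cancelˡ (t * D) _ _ (begin
        t * D + (evℕ (x· a) x + t * δ)
          ≡⟨ cong (λ y → t * D + (y + t * δ)) (trans (ev-cong step x) (ev-+ shifted (λ i → t * (d i · 1#)) x)) ⟩
        t * D + (ev shifted x + ev (λ i → t * (d i · 1#)) x + t * δ)
          ≡⟨ cong (λ y → t * D + (ev shifted x + y + t * δ)) (ev-* t (λ i → d i · 1#) x) ⟩
        t * D + (0# + x * I + t * D + t * δ)
          ≡⟨ solve 5 (λ t D x I δ → t :* D :+ (con 0 :+ x :* I :+ t :* D :+ t :* δ)
                                 := t :* D :+ (x :* I :+ t :* (D :+ δ))) refl t D x I δ ⟩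
        t * D + (x * I + t * (D + δ))
          ≡⟨ cong (λ y → t * D + (x * I + t * y)) x^k ⟨
        t * D + (x * I + t * (x * x ^ k′))
          ≡⟨ cong (t * D +_) (solve 4 (λ x I t z → x :* I :+ t :* (x :* z) := x :* (I :+ t :* z)) refl x I t (x ^ k′)) ⟩
        t * D + x * (I + t * x ^ k′)
          ≡⟨ cong (λ y → t * D + x * y) (ev-init-last (λ i → a i · 1#) x) ⟨
        t * D + x * evℕ a x ∎)
        where
          t = top a · 1#
          D = evℕ d x
          I = evℕ (a ∘ inject₁) x
          shifted : Fin k → Carrier
          shifted zero    = 0#
          shifted (suc i) = a (inject₁ i) · 1#
          step : ∀ i → x· a i · 1# ≡ shifted i + t * (d i · 1#)
          step zero    = trans (·1-homo-* (top a) (d zero)) (sym (+-identityˡ _))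
          step (suc i) = trans (·-homo-+ 1# (a (inject₁ i)) _) (cong (a (inject₁ i) · 1# +_) (·1-homo-* (top a) (d (suc i))))

      ^-reduce : ∀ n → x ^ (k ℕ.+ n) ≡ δ * (evℕ (cofactor n) x + x ^ n) + evℕ (remainder n) x
      ^-reduce zero    = begin
        x ^ (k ℕ.+ 0)                  ≡⟨ cong (x ^_) (ℕ.+-identityʳ k) ⟩
        x ^ k                          ≡⟨ x^k ⟩
        evℕ d x + δ                    ≡⟨ solve 2 (λ D δ → D :+ δ := δ :* (con 0 :+ con 1) :+ D) refl (evℕ d x) δ ⟩
        δ * (0# + 1#) + evℕ d x        ∎
      ^-reduce (suc n) = begin
        x ^ (k ℕ.+ suc n)               ≡⟨ cong (x ^_) (ℕ.+-suc k n) ⟩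
        x * x ^ (k ℕ.+ n)               ≡⟨ cong (x *_) (^-reduce n) ⟩
        x * (δ * (H + X) + R)           ≡⟨ solve 5 (λ x δ H X R → x :* (δ :* (H :+ X) :+ R) := x :* R :+ δ :* (x :* H :+ x :* X)) refl x δ H X R ⟩
        x * R + δ * (x * H + x * X)     ≡⟨ cong (_+ δ * (x * H + x * X)) (evℕ-x· (remainder n)) ⟨
        evℕ (remainder (suc n)) x + t * δ + δ * (x * H + x * X)
          ≡⟨ solve 6 (λ R′ t δ x H X → R′ :+ t :* δ :+ δ :* (x :* H :+ x :* X) := δ :* (t :+ x :* H :+ x :* X) :+ R′) refl
               (evℕ (remainder (suc n)) x) t δ x H X ⟩
        δ * (t + x * H + x * X) + evℕ (remainder (suc n)) x ∎
        where
          t = top (remainder n) · 1#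
          H = evℕ (cofactor n) x
          X = x ^ n
          R = evℕ (remainder n) x

-- The embedding of F in E, the basis of E over its image, and the retraction

module Embedding {q N p k′ r′ : ℕ} (F : FiniteField q) (E : FiniteField N) (p-prime : Prime p)
                 (q≡p^k : q ≡ p ℕ.^ suc k′) (N≡q^r : N ≡ q ℕ.^ suc r′) where
  private
    module F where
      open FieldTheory F public
      open Polynomials F public
      open PrimeField F public
    module E where
      open FieldTheory E public
      open Polynomials E public
      open PrimeField E public
  open ≡-Reasoning
  k = suc k′

  1<p : 1 < p
  1<p = ℕ.nonTrivial⇒n>1 p {{prime⇒nonTrivial p-prime}}

  p≢0 : p ≢ 0
  p≢0 refl with () ← 1<p

  F-char : p F.· F.1# ≡ F.0#
  F-char = F.characteristic p k q≡p^k

  E-char : p E.· E.1# ≡ E.0#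
  E-char = E.characteristic p (k ℕ.* suc r′)
    (trans N≡q^r (trans (cong (ℕ._^ suc r′) q≡p^k) (ℕ.^-*-assoc p k (suc r′))))

  F-add : F.AdditivePower p
  F-add = F.frobenius p-prime F-char

  open F.PowerBasis {p} {k′} q≡p^k 1<p F-add renaming (γ to α) using (spanning; unique)

  coefficients-unique : (a b : Fin k → ℕ) → F.evℕ a α ≡ F.evℕ b α → ∀ i → a i F.· F.1# ≡ b i F.· F.1#
  coefficients-unique a b = unique (λ i → a i F.· F.1#) (λ i → b i F.· F.1#)
                                   (λ i → F.·1-fixed p≢0 F-add (a i)) (λ i → F.·1-fixed p≢0 F-add (b i))

  F-scalar : Fin p → F.Carrier
  F-scalar c = toℕ c F.· F.1#

  expand : ∀ x → ∃ λ (c : Fin k → Fin p) → F.ev (F-scalar ∘ c) α ≡ x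
  expand = spanning F-scalar
    (λ eq → Fin.toℕ-injective (F.·1-injective p-prime F-char (Fin.toℕ<n _) (Fin.toℕ<n _) eq))
    (λ c → F.·1-fixed p≢0 F-add (toℕ c))

  coefficients : F.Carrier → Fin k → ℕ
  coefficients x = toℕ ∘ proj₁ (expand x)

  coefficients-ev : ∀ x → F.evℕ (coefficients x) α ≡ x
  coefficients-ev x = proj₂ (expand x)

  -- Equality in F means congruence modulo p, and E has the same characteristic.
  scalar-transfer : ∀ m n → m F.· F.1# ≡ n F.· F.1# → m E.· E.1# ≡ n E.· E.1#
  scalar-transfer m n eq = begin
    m E.· E.1#        ≡⟨ E.·1-% p-prime E-char m ⟩
    (m % p) E.· E.1#  ≡⟨ cong (E._· E.1#) (F.·1-injective p-prime F-char (m%n<n m p) (m%n<n n p)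
                           (trans (sym (F.·1-% p-prime F-char m)) (trans eq (F.·1-% p-prime F-char n)))) ⟩
    (n % p) E.· E.1#  ≡⟨ E.·1-% p-prime E-char n ⟨
    n E.· E.1#        ∎
    where instance _ = prime⇒nonZero p-prime

  -- Coefficients with respect to 1, α, ..., α^(k-1) are unique modulo p, so agreement at the single
  -- point α is agreement of polynomials modulo p.
  transfer : ∀ (a b : Fin k → ℕ) → F.evℕ a α ≡ F.evℕ b α → ∀ y → E.evℕ a y ≡ E.evℕ b y
  transfer a b eq = E.ev-cong (λ i → scalar-transfer (a i) (b i) (coefficients-unique a b eq i))

  -- x^k - d(x) is the minimal polynomial of α over the prime field, with coefficients lifted to ℕ.
  d : Fin k → ℕ
  d = coefficients (α F.^ k)

  open Reduction d using (x·; remainder; cofactor; evℕ-x·; ^-reduce)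

  α^k : α F.^ k ≡ F.evℕ d α F.+ F.0#
  α^k = trans (sym (coefficients-ev (α F.^ k))) (sym (F.+-identityʳ _))

  α-remainder : ∀ n → α F.^ (k ℕ.+ n) ≡ F.evℕ (remainder n) α
  α-remainder n = trans (^-reduce F α^k n) (trans (cong (F._+ F.evℕ (remainder n) α) (F.zeroˡ _)) (F.+-identityˡ _))

  1<q : 1 < q
  1<q = subst (1 <_) (sym q≡p^k) (1<^ 1<p k′)

  1<N : 1 < N
  1<N = subst (1 <_) (sym N≡q^r) (1<^ 1<q r′)

  -- N - 2. Writing the exponent N - 1 as `suc M` gives `cofactor (suc M)` a constant term, from
  -- which 1 can be subtracted below.
  M : ℕ
  M = ℕ.pred (ℕ.pred N)

  N≡2+M : N ≡ suc (suc M)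
  N≡2+M with s≤s (s≤s _) ← 1<N = refl

  ^-period : ∀ {A : Set} (_^_ : A → ℕ → A) → (∀ x → x ^ (k ℕ.+ suc M) ≡ x ^ (k′ ℕ.+ N))
  ^-period _^_ x = cong (x ^_) (trans (sym (ℕ.+-suc k′ (suc M))) (cong (k′ ℕ.+_) (sym N≡2+M)))

  α^N≡α : α F.^ N ≡ α
  α^N≡α = trans (cong (α F.^_) N≡q^r) (F.fixed-^ {q} (F.x^Q≡x α) (suc r′))

  F-period : α F.^ (k ℕ.+ suc M) ≡ α F.^ k
  F-period = begin
    α F.^ (k ℕ.+ suc M)      ≡⟨ ^-period F._^_ α ⟩
    α F.^ (k′ ℕ.+ N)         ≡⟨ F.^-homo-* α k′ N ⟩
    α F.^ k′ F.* α F.^ N     ≡⟨ cong (α F.^ k′ F.*_) α^N≡α ⟩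
    α F.^ k′ F.* α           ≡⟨ F.*-comm _ _ ⟩
    α F.^ k                  ∎

  E-period : ∀ y → y E.^ (k ℕ.+ suc M) ≡ y E.^ k
  E-period y = begin
    y E.^ (k ℕ.+ suc M)      ≡⟨ ^-period E._^_ y ⟩
    y E.^ (k′ ℕ.+ N)         ≡⟨ E.^-homo-* y k′ N ⟩
    y E.^ k′ E.* y E.^ N     ≡⟨ cong (y E.^ k′ E.*_) (E.x^Q≡x y) ⟩
    y E.^ k′ E.* y           ≡⟨ E.*-comm _ _ ⟩
    y E.^ k                  ∎

  -- β^(k+N−1) = β^k for every β, so if x^k − d(x) has no root in E, then the monic polynomial
  -- x^(N−1) + cofactor − 1 of degree N − 1 vanishes at all N elements of E.
  defect : E.Carrier → E.Carrier
  defect y = y E.^ k E.- E.evℕ d y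

  y^k : ∀ y → y E.^ k ≡ E.evℕ d y E.+ defect y
  y^k y = E.y≡x+[y-x] (E.evℕ d y) (y E.^ k)

  -- Divide y^(k+N-1) = y^k by x^k - d(x): on the right the quotient is 1 and the remainder d, on
  -- the left the remainder is d as well. Cancelling d(y) and then the nonzero defect equates the
  -- quotients at y.
  defect-equation : ∀ y → defect y ≢ E.0# → E.evℕ (cofactor (suc M)) y E.+ y E.^ suc M ≡ E.1#
  defect-equation y δ≢0 = E.*-cancelˡ (defect y) δ≢0 (E.+-cancelʳ (E.evℕ d y) _ _ (begin
    defect y E.* (E.evℕ (cofactor (suc M)) y E.+ y E.^ suc M) E.+ E.evℕ d y
      ≡⟨ cong (defect y E.* (E.evℕ (cofactor (suc M)) y E.+ y E.^ suc M) E.+_) (transfer d (remainder (suc M)) d≡remainder y) ⟩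
    defect y E.* (E.evℕ (cofactor (suc M)) y E.+ y E.^ suc M) E.+ E.evℕ (remainder (suc M)) y
      ≡⟨ ^-reduce E (y^k y) (suc M) ⟨
    y E.^ (k ℕ.+ suc M)            ≡⟨ E-period y ⟩
    y E.^ k                        ≡⟨ y^k y ⟩
    E.evℕ d y E.+ defect y         ≡⟨ E.+-comm _ _ ⟩
    defect y E.+ E.evℕ d y         ≡⟨ cong (E._+ E.evℕ d y) (E.*-identityʳ _) ⟨
    defect y E.* E.1# E.+ E.evℕ d y ∎))
    where
      -- At α the defect is 0, so a power of α equals its remainder, and α^(k+N-1) = α^k also holds
      -- in F.
      d≡remainder : F.evℕ d α ≡ F.evℕ (remainder (suc M)) α
      d≡remainder = trans (coefficients-ev (α F.^ k)) (trans (sym F-period) (α-remainder (suc M)))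

  root : ∃ λ i → defect (E.enum i) ≡ E.0#
  root with Fin.any? (λ i → defect (E.enum i) E.≟ E.0#)
  ... | yes found = found
  ... | no none = contradiction vanishing (E.monic-root-bound c xs
          (λ eq → Fin.toℕ-injective (trans (sym (Fin.toℕ-cast _ _)) (trans (cong toℕ (E.enum-injective eq)) (Fin.toℕ-cast _ _)))))
    where
      xs : Fin (suc (suc M)) → E.Carrier
      xs = E.enum ∘ Fin.cast (sym N≡2+M)
      c₀ = cofactor (suc M) zero E.· E.1#
      c : Fin (suc M) → E.Carrier
      c zero    = c₀ E.- E.1#
      c (suc i) = cofactor M i E.· E.1#
      vanishing : ∀ i → E.ev c (xs i) E.+ xs i E.^ suc M ≡ E.0#
      vanishing i = begin
        c₀ E.- E.1# E.+ z E.+ xs i E.^ suc M     ≡⟨ cong (λ w → w E.+ z E.+ xs i E.^ suc M) (E.+-comm c₀ _) ⟩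
        E.- E.1# E.+ c₀ E.+ z E.+ xs i E.^ suc M ≡⟨ cong (E._+ xs i E.^ suc M) (E.+-assoc _ c₀ z) ⟩
        E.- E.1# E.+ (c₀ E.+ z) E.+ xs i E.^ suc M ≡⟨ E.+-assoc _ _ _ ⟩
        E.- E.1# E.+ (c₀ E.+ z E.+ xs i E.^ suc M) ≡⟨ cong (E.- E.1# E.+_) (defect-equation (xs i) (λ eq → none (_ , eq))) ⟩
        E.- E.1# E.+ E.1#                        ≡⟨ E.-‿inverseˡ E.1# ⟩
        E.0#                                     ∎
        where z = xs i E.* E.evℕ (cofactor M) (xs i)

  β : E.Carrier
  β = E.enum (proj₁ root)

  β^k : β E.^ k ≡ E.evℕ d β E.+ E.0#
  β^k = trans (y^k β) (cong (E.evℕ d β E.+_) (proj₂ root))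

  φ : F.Carrier → E.Carrier
  φ x = E.evℕ (coefficients x) β

  -- The value of φ does not depend on the representative. The homomorphism laws follow by
  -- evaluating whichever coefficient vector makes them visible.
  φ-ev : ∀ a → φ (F.evℕ a α) ≡ E.evℕ a β
  φ-ev a = transfer (coefficients (F.evℕ a α)) a (coefficients-ev (F.evℕ a α)) β

  φ-+ : ∀ x y → φ (x F.+ y) ≡ φ x E.+ φ y
  φ-+ x y = begin
    φ (x F.+ y)                                        ≡⟨ cong φ (cong₂ F._+_ (coefficients-ev x) (coefficients-ev y)) ⟨
    φ (F.evℕ a α F.+ F.evℕ b α)                        ≡⟨ cong φ (F.evℕ-+ a b α) ⟨
    φ (F.evℕ (λ i → a i ℕ.+ b i) α)                    ≡⟨ φ-ev (λ i → a i ℕ.+ b i) ⟩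
    E.evℕ (λ i → a i ℕ.+ b i) β                        ≡⟨ E.evℕ-+ a b β ⟩
    φ x E.+ φ y                                        ∎
    where
      a = coefficients x
      b = coefficients y

  φ-·1 : ∀ c y → φ (c F.· F.1# F.* y) ≡ c E.· E.1# E.* φ y
  φ-·1 c y = begin
    φ (c F.· F.1# F.* y)                  ≡⟨ cong (λ z → φ (c F.· F.1# F.* z)) (coefficients-ev y) ⟨
    φ (c F.· F.1# F.* F.evℕ b α)          ≡⟨ cong φ (F.evℕ-* c b α) ⟨
    φ (F.evℕ (λ i → c ℕ.* b i) α)         ≡⟨ φ-ev (λ i → c ℕ.* b i) ⟩
    E.evℕ (λ i → c ℕ.* b i) β             ≡⟨ E.evℕ-* c b β ⟩
    c E.· E.1# E.* φ y                    ∎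
    where b = coefficients y

  -- α and β satisfy the same equation x^k = d(x), so `x·` computes multiplication by α in F and by
  -- β in E.
  φ-α* : ∀ y → φ (α F.* y) ≡ β E.* φ y
  φ-α* y = begin
    φ (α F.* y)                                    ≡⟨ cong (λ z → φ (α F.* z)) (coefficients-ev y) ⟨
    φ (α F.* F.evℕ b α)                            ≡⟨ cong φ (evℕ-x· F α^k b) ⟨
    φ (F.evℕ (x· b) α F.+ t F.· F.1# F.* F.0#)     ≡⟨ cong φ (trans (cong (F.evℕ (x· b) α F.+_) (F.zeroʳ _)) (F.+-identityʳ _)) ⟩
    φ (F.evℕ (x· b) α)                             ≡⟨ φ-ev (x· b) ⟩
    E.evℕ (x· b) β                                 ≡⟨ trans (cong (E.evℕ (x· b) β E.+_) (E.zeroʳ _)) (E.+-identityʳ _) ⟨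
    E.evℕ (x· b) β E.+ t E.· E.1# E.* E.0#         ≡⟨ evℕ-x· E β^k b ⟩
    β E.* φ y                                      ∎
    where
      b = coefficients y
      t = b (Fin.fromℕ k′)

  φ-const : ∀ c → φ (c F.· F.1#) ≡ c E.· E.1#
  φ-const c = begin
    φ (c F.· F.1#)      ≡⟨ cong φ (F.ev-const (λ i → a i F.· F.1#) (λ _ → refl) α) ⟨
    φ (F.evℕ a α)       ≡⟨ φ-ev a ⟩
    E.evℕ a β           ≡⟨ E.ev-const (λ i → a i E.· E.1#) (λ _ → refl) β ⟩
    c E.· E.1#          ∎
    where
      a : Fin k → ℕ
      a zero    = c
      a (suc _) = 0

  φ-0 : φ F.0# ≡ E.0#
  φ-0 = φ-const 0

  φ-1 : φ F.1# ≡ E.1#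
  φ-1 = trans (cong φ (sym (F.+-identityʳ F.1#))) (trans (φ-const 1) (E.+-identityʳ E.1#))

  -- Horner's scheme builds the left factor from scalars and multiplications by α, the two cases
  -- already settled.
  φ-ev-* : ∀ {n} (a : Fin n → ℕ) y → φ (F.evℕ a α F.* y) ≡ E.evℕ a β E.* φ y
  φ-ev-* {zero}  a y = trans (cong φ (F.zeroˡ y)) (trans φ-0 (sym (E.zeroˡ _)))
  φ-ev-* {suc n} a y = begin
    φ ((c F.+ α F.* e) F.* y)                         ≡⟨ cong φ (F.distribʳ y c (α F.* e)) ⟩
    φ (c F.* y F.+ α F.* e F.* y)                     ≡⟨ φ-+ _ _ ⟩
    φ (c F.* y) E.+ φ (α F.* e F.* y)                 ≡⟨ cong₂ E._+_ (φ-·1 (a zero) y) (trans (cong φ (F.*-assoc α e y)) (φ-α* (e F.* y))) ⟩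
    c′ E.* φ y E.+ β E.* φ (e F.* y)                  ≡⟨ cong (λ z → c′ E.* φ y E.+ β E.* z) (φ-ev-* (a ∘ suc) y) ⟩
    c′ E.* φ y E.+ β E.* (e′ E.* φ y)                 ≡⟨ cong (c′ E.* φ y E.+_) (E.*-assoc β e′ (φ y)) ⟨
    c′ E.* φ y E.+ β E.* e′ E.* φ y                   ≡⟨ E.distribʳ (φ y) c′ (β E.* e′) ⟨
    (c′ E.+ β E.* e′) E.* φ y                         ∎
    where
      c = a zero F.· F.1#
      c′ = a zero E.· E.1#
      e = F.evℕ (a ∘ suc) α
      e′ = E.evℕ (a ∘ suc) β

  φ-* : ∀ x y → φ (x F.* y) ≡ φ x E.* φ y
  φ-* x y = trans (cong (λ z → φ (z F.* y)) (sym (coefficients-ev x))) (φ-ev-* (coefficients x) y)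

  φ-^ : ∀ x n → φ (x F.^ n) ≡ φ x E.^ n
  φ-^ x zero    = φ-1
  φ-^ x (suc n) = trans (φ-* x (x F.^ n)) (cong (φ x E.*_) (φ-^ x n))

  φ-fixed : ∀ x → φ x E.^ q ≡ φ x
  φ-fixed x = trans (sym (φ-^ x q)) (cong φ (F.x^Q≡x x))

  φ-≢0 : ∀ {x} → x ≢ F.0# → φ x ≢ E.0#
  φ-≢0 {x} x≢0 φx≡0 with x′ , xx′≡1 ← F.inverse x x≢0 = E.0≢1 (begin
    E.0#             ≡⟨ E.zeroˡ (φ x′) ⟨
    E.0# E.* φ x′    ≡⟨ cong (E._* φ x′) φx≡0 ⟨
    φ x E.* φ x′     ≡⟨ φ-* x x′ ⟨
    φ (x F.* x′)     ≡⟨ cong φ xx′≡1 ⟩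
    φ F.1#           ≡⟨ φ-1 ⟩
    E.1#             ∎)

  φ-injective : Injective _≡_ _≡_ φ
  φ-injective {x} {y} eq with (x F.- y) F.≟ F.0#
  ... | yes x-y≡0 = F.x∙y⁻¹≈ε⇒x≈y x y x-y≡0
  ... | no x-y≢0  = contradiction (E.+-cancelˡ (φ y) _ _ (begin
    φ y E.+ φ (x F.- y)   ≡⟨ φ-+ y (x F.- y) ⟨
    φ (y F.+ (x F.- y))   ≡⟨ cong φ (F.y≡x+[y-x] y x) ⟨
    φ x                   ≡⟨ eq ⟩
    φ y                   ≡⟨ E.+-identityʳ _ ⟨
    φ y E.+ E.0#          ∎)) (φ-≢0 x-y≢0)

  E-add : E.AdditivePower q
  E-add = subst E.AdditivePower (sym q≡p^k) (E.AdditivePower-^ {p} (E.frobenius p-prime E-char) k)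

  open E.PowerBasis {q} {r′} N≡q^r 1<q E-add public using (γ)
  private module B = E.PowerBasis {q} {r′} N≡q^r 1<q E-add

  combination : (Fin (suc r′) → F.Carrier) → E.Carrier
  combination c = E.ev (φ ∘ c) γ

  combination-injective : ∀ c c′ → combination c ≡ combination c′ → c ≗ c′
  combination-injective c c′ eq i =
    φ-injective (B.unique (φ ∘ c) (φ ∘ c′) (λ i → φ-fixed (c i)) (λ i → φ-fixed (c′ i)) eq i)

  coordinates : E.Carrier → Fin (suc r′) → F.Carrier
  coordinates x = F.enum ∘ proj₁ (B.spanning (φ ∘ F.enum) (F.enum-injective ∘ φ-injective) (λ i → φ-fixed _) x)

  combination-coordinates : ∀ x → combination (coordinates x) ≡ x
  combination-coordinates x = proj₂ (B.spanning (φ ∘ F.enum) (F.enum-injective ∘ φ-injective) (λ i → φ-fixed _) x)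

  π : E.Carrier → F.Carrier
  π x = coordinates x zero

  π-combination : ∀ c → π (combination c) ≡ c zero
  π-combination c = combination-injective (coordinates (combination c)) c (combination-coordinates (combination c)) zero

  π-+ : ∀ x y → π (x E.+ y) ≡ π x F.+ π y
  π-+ x y = begin
    π (x E.+ y)                             ≡⟨ cong π (cong₂ E._+_ (combination-coordinates x) (combination-coordinates y)) ⟨
    π (combination a E.+ combination b)     ≡⟨ cong π (E.ev-+ (φ ∘ a) (φ ∘ b) γ) ⟨
    π (E.ev (λ i → φ (a i) E.+ φ (b i)) γ)  ≡⟨ cong π (E.ev-cong (λ i → φ-+ (a i) (b i)) γ) ⟨
    π (combination (λ i → a i F.+ b i))     ≡⟨ π-combination (λ i → a i F.+ b i) ⟩
    π x F.+ π y                             ∎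
    where
      a = coordinates x
      b = coordinates y

  π-φ* : ∀ c x → π (φ c E.* x) ≡ c F.* π x
  π-φ* c x = begin
    π (φ c E.* x)                         ≡⟨ cong (λ y → π (φ c E.* y)) (combination-coordinates x) ⟨
    π (φ c E.* combination a)             ≡⟨ cong π (E.ev-* (φ c) (φ ∘ a) γ) ⟨
    π (E.ev (λ i → φ c E.* φ (a i)) γ)    ≡⟨ cong π (E.ev-cong (λ i → φ-* c (a i)) γ) ⟨
    π (combination (λ i → c F.* a i))     ≡⟨ π-combination (λ i → c F.* a i) ⟩
    c F.* π x                             ∎
    where a = coordinates x

  -- The basis starts with γ^0 = 1, so the coordinates of φ(c) are c, 0, ..., 0.
  π-φ : ∀ c → π (φ c) ≡ c
  π-φ c = trans (cong π (sym (E.ev-const (φ ∘ a) (λ _ → φ-0) γ))) (π-combination a)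
    where
      a : Fin (suc r′) → F.Carrier
      a zero    = c
      a (suc _) = F.0#

-- Flattening the index pairs (i, j) with j < d_i into one range

splitΣ : ∀ {s} (d : Fin s → ℕ) → Fin (sumℕ d) → Σ (Fin s) (Fin ∘ d)
splitΣ {suc s} d k with splitAt (d zero) k
... | inj₁ j = zero , j
... | inj₂ l = let i , j = splitΣ (d ∘ suc) l in suc i , j

joinΣ : ∀ {s} (d : Fin s → ℕ) → Σ (Fin s) (Fin ∘ d) → Fin (sumℕ d)
joinΣ d (zero  , j) = j ↑ˡ _
joinΣ d (suc i , j) = d zero ↑ʳ joinΣ (d ∘ suc) (i , j)

splitΣ-joinΣ : ∀ {s} (d : Fin s → ℕ) ij → splitΣ d (joinΣ d ij) ≡ ij
splitΣ-joinΣ d (zero  , j) rewrite Fin.splitAt-↑ˡ (d zero) j (sumℕ (d ∘ suc)) = refl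
splitΣ-joinΣ d (suc i , j)
  rewrite Fin.splitAt-↑ʳ (d zero) (sumℕ (d ∘ suc)) (joinΣ (d ∘ suc) (i , j))
        | splitΣ-joinΣ (d ∘ suc) (i , j) = refl

joinΣ-splitΣ : ∀ {s} (d : Fin s → ℕ) k → joinΣ d (splitΣ d k) ≡ k
joinΣ-splitΣ {suc s} d k with splitAt (d zero) k in eq
... | inj₁ j = Fin.splitAt⁻¹-↑ˡ eq
... | inj₂ l = trans (cong (d zero ↑ʳ_) (joinΣ-splitΣ (d ∘ suc) l)) (Fin.splitAt⁻¹-↑ʳ eq)

∑ℕ-const : ∀ n x → ∑ℕ {n} (λ _ → x) ≡ n ℕ.* x
∑ℕ-const zero    x = refl
∑ℕ-const (suc n) x = cong (x ℕ.+_) (∑ℕ-const n x)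

-- Elementary intervals as conditions on leading digits

module _ {b : ℕ} .{{_ : NonZero b}} where
  open import Data.Nat using (_+_; _*_; _^_)

  -- Both sides read x as a base-b numeral with index 0 most significant, so the bijection between
  -- functions and `Fin (b ^ m)` becomes available for numerators of points.
  horner≡funToFin : ∀ {m} (x : Fin m → Fin b) →
                    sumℕ (λ j → toℕ (x j) * b ^ (m ∸ 1 ∸ toℕ j)) ≡ toℕ (funToFin x)
  horner≡funToFin {zero}  x = refl
  horner≡funToFin {suc m} x = begin
    toℕ (x zero) * b ^ m + sumℕ (λ j → toℕ (x (suc j)) * b ^ (m ∸ suc (toℕ j)))
      ≡⟨ cong₂ _+_ (ℕ.*-comm (toℕ (x zero)) (b ^ m)) (trans (sumℕ-cong (λ j →
           cong (λ k → toℕ (x (suc j)) * b ^ k) (sym (ℕ.∸-+-assoc m 1 (toℕ j))))) (horner≡funToFin (x ∘ suc))) ⟩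
    b ^ m * toℕ (x zero) + toℕ (funToFin (x ∘ suc))
      ≡⟨ Fin.toℕ-combine (x zero) (funToFin (x ∘ suc)) ⟨
    toℕ (funToFin x) ∎
    where
      open ≡-Reasoning
      sumℕ-cong : ∀ {n} {f g : Fin n → ℕ} → f ≗ g → sumℕ f ≡ sumℕ g
      sumℕ-cong {zero}  f≗g = refl
      sumℕ-cong {suc n} f≗g = cong₂ _+_ (f≗g zero) (sumℕ-cong (f≗g ∘ suc))

  -- Division with remainder by b^(m-d): the quotient is the numeral formed by the first d digits.
  leading-digits : ∀ {m d} (x : Fin m → Fin b) (d≤m : d ≤ m) → ∃ λ low → low < b ^ (m ∸ d) ×
                   toℕ (funToFin x) ≡ toℕ (funToFin (λ j → x (inject≤ j d≤m))) * b ^ (m ∸ d) + low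
  leading-digits {m} x z≤n = toℕ (funToFin x) , Fin.toℕ<n (funToFin x) , refl
  leading-digits {suc m} {suc d} x (s≤s d≤m) with low , low< , eq ← leading-digits (x ∘ suc) d≤m =
    low , low< , (begin
      toℕ (funToFin x)                                  ≡⟨ Fin.toℕ-combine (x zero) (funToFin (x ∘ suc)) ⟩
      b ^ m * x₀ + toℕ (funToFin (x ∘ suc))             ≡⟨ cong₂ (λ y z → y * x₀ + z) b^m eq ⟩
      b ^ d * B * x₀ + (T * B + low)                    ≡⟨ arithmetic (b ^ d) B x₀ T low ⟩
      (b ^ d * x₀ + T) * B + low                        ≡⟨ cong (λ y → y * B + low) (Fin.toℕ-combine (x zero) _) ⟨
      toℕ (funToFin (λ j → x (inject≤ j (s≤s d≤m)))) * B + low ∎)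
    where
      open ≡-Reasoning
      open import Data.Nat.Solver using (module +-*-Solver)
      x₀ = toℕ (x zero)
      B = b ^ (m ∸ d)
      T = toℕ (funToFin (λ j → x (suc (inject≤ j d≤m))))
      b^m : b ^ m ≡ b ^ d * B
      b^m = trans (cong (b ^_) (sym (ℕ.m+[n∸m]≡n d≤m))) (ℕ.^-distribˡ-+-* b d (m ∸ d))
      arithmetic : ∀ a B x T l → a * B * x + (T * B + l) ≡ (a * x + T) * B + l
      arithmetic = +-*-Solver.solve 5 (λ a B x T l → a :* B :* x :+ (T :* B :+ l) := (a :* x :+ T) :* B :+ l) refl
        where open +-*-Solver

  module _ {m d : ℕ} (d≤m : d ≤ m) (x : Fin m → Fin b) (t : Fin d → Fin b) where
    private
      X = sumℕ (λ j → toℕ (x j) * b ^ (m ∸ 1 ∸ toℕ j))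
      a = toℕ (funToFin t)
      B = b ^ (m ∸ d)
      T = toℕ (funToFin (λ j → x (inject≤ j d≤m)))
      low = proj₁ (leading-digits x d≤m)

      X≡ : X ≡ T * B + low
      X≡ = trans (horner≡funToFin x) (proj₂ (proj₂ (leading-digits x d≤m)))

      scale : ∀ y → y * b ^ m ≡ y * B * b ^ d
      scale y = trans (cong (y *_) (trans (cong (b ^_) (sym (ℕ.m∸n+n≡m d≤m))) (ℕ.^-distribˡ-+-* b (m ∸ d) d)))
                      (sym (ℕ.*-assoc y B (b ^ d)))

      TB≤X : T * B ≤ X
      TB≤X = subst (T * B ≤_) (sym X≡) (ℕ.m≤m+n (T * B) low)

      X<[1+T]B : X < suc T * B
      X<[1+T]B = subst (_< suc T * B) (sym X≡) (subst (T * B + low <_) (ℕ.+-comm (T * B) B)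
                   (ℕ.+-monoʳ-< (T * B) (proj₁ (proj₂ (leading-digits x d≤m)))))

      instance _ = ℕ.m^n≢0 b d

    -- X lies in the blocks [T B, (T+1) B) and [a B, (a+1) B). Blocks of one grid that share a point
    -- coincide, so T = a, and numerals determine their digits.
    inCoord⇒digits : InCoord b m d a X → ∀ j → x (inject≤ j d≤m) ≡ t j
    inCoord⇒digits (lo , hi) j = trans (sym (Fin.finToFun-funToFin _ j))
      (trans (cong (λ k → finToFun k j) (Fin.toℕ-injective T≡a)) (Fin.finToFun-funToFin t j))
      where
        T≡a : T ≡ a
        T≡a = ℕ.≤-antisym
          (ℕ.≤-pred (ℕ.*-cancelʳ-< B T (suc a) (ℕ.≤-<-trans TB≤X
            (ℕ.*-cancelʳ-< (b ^ d) X (suc a * B) (subst (X * b ^ d <_) (scale (suc a)) hi)))))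
          (ℕ.≤-pred (ℕ.*-cancelʳ-< B a (suc T) (ℕ.≤-<-trans
            (ℕ.*-cancelʳ-≤ (a * B) X (b ^ d) (subst (_≤ X * b ^ d) (scale a) lo)) X<[1+T]B)))

    digits⇒inCoord : (∀ j → x (inject≤ j d≤m) ≡ t j) → InCoord b m d a X
    digits⇒inCoord eq =
      subst (_≤ X * b ^ d) (sym (scale a)) (ℕ.*-monoˡ-≤ (b ^ d) (subst (λ y → y * B ≤ X) T≡a TB≤X)) ,
      subst (X * b ^ d <_) (sym (scale (suc a))) (ℕ.*-monoˡ-< (b ^ d) (subst (λ y → X < suc y * B) T≡a X<[1+T]B))
      where
        T≡a : T ≡ a
        T≡a = cong toℕ (funToFin-cong eq)

-- Vectors as indices, and the number of solutions of linear systems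

module Nets {Q : ℕ} (F : FiniteField Q) where
  open FieldTheory F
  open ≡-Reasoning

  instance
    _ : NonZero Q
    _ = Q-nonZero F

  -- Inverse to `digit`: the index n of a point is read with its least significant digit first,
  -- opposite to the digits of the coordinates.
  encode : ∀ {m} → (Fin m → Fin Q) → ℕ
  encode {zero}  f = 0
  encode {suc m} f = toℕ (f zero) ℕ.+ encode (f ∘ suc) ℕ.* Q

  encode< : ∀ {m} (f : Fin m → Fin Q) → encode f < Q ℕ.^ m
  encode< {zero}  f = s≤s z≤n
  encode< {suc m} f = ℕ.<-≤-trans (ℕ.+-monoˡ-< (encode (f ∘ suc) ℕ.* Q) (Fin.toℕ<n (f zero)))
    (ℕ.≤-trans (ℕ.*-monoˡ-≤ Q (encode< (f ∘ suc))) (ℕ.≤-reflexive (ℕ.*-comm (Q ℕ.^ m) Q)))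

  encode-cong : ∀ {m} {f g : Fin m → Fin Q} → f ≗ g → encode f ≡ encode g
  encode-cong {zero}  f≗g = refl
  encode-cong {suc m} f≗g = cong₂ (λ a e → toℕ a ℕ.+ e ℕ.* Q) (f≗g zero) (encode-cong (f≗g ∘ suc))

  digit-encode : ∀ {m} (f : Fin m → Fin Q) k → digit F (encode f) (toℕ k) ≡ f k
  digit-encode f zero    = Fin.toℕ-injective (trans (Fin.toℕ-fromℕ< _)
    (trans ([m+kn]%n≡m%n (toℕ (f zero)) (encode (f ∘ suc)) Q) (m<n⇒m%n≡m (Fin.toℕ<n (f zero)))))
  digit-encode f (suc k) = trans (cong (λ n → digit F n (toℕ k)) quotient≡) (digit-encode (f ∘ suc) k)
    where
      e = encode (f ∘ suc)
      quotient≡ : encode f / Q ≡ e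
      quotient≡ = trans (+-distrib-/-∣ʳ (toℕ (f zero)) (n∣m*n e))
        (cong₂ ℕ._+_ (m<n⇒m/n≡0 (Fin.toℕ<n (f zero))) (m*n/n≡m e Q))

  encode-digit : ∀ m n → n < Q ℕ.^ m → encode {m} (λ k → digit F n (toℕ k)) ≡ n
  encode-digit zero    n n<1 = sym (ℕ.n<1⇒n≡0 n<1)
  encode-digit (suc m) n n<  = begin
    toℕ (digit F n 0) ℕ.+ encode {m} (λ k → digit F (n / Q) (toℕ k)) ℕ.* Q
      ≡⟨ cong₂ (λ a e → a ℕ.+ e ℕ.* Q) (Fin.toℕ-fromℕ< _)
           (encode-digit m (n / Q) (m<n*o⇒m/o<n (subst (n <_) (ℕ.*-comm Q (Q ℕ.^ m)) n<))) ⟩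
    n % Q ℕ.+ n / Q ℕ.* Q  ≡⟨ m≡m%n+[m/n]*n n Q ⟨
    n                      ∎

  vector : ∀ m → Fin (Q ℕ.^ m) → Fin m → Carrier
  vector m n k = enum (digit F (toℕ n) (toℕ k))

  code : ∀ {m} → (Fin m → Carrier) → Fin (Q ℕ.^ m)
  code v = fromℕ< (encode< (index ∘ v))

  vector-code : ∀ {m} (v : Fin m → Carrier) → vector _ (code v) ≗ v
  vector-code v k = begin
    enum (digit F (toℕ (code v)) (toℕ k))           ≡⟨ cong (λ n → enum (digit F n (toℕ k))) (Fin.toℕ-fromℕ< (encode< (index ∘ v))) ⟩
    enum (digit F (encode (index ∘ v)) (toℕ k))     ≡⟨ cong enum (digit-encode (index ∘ v) k) ⟩
    enum (index (v k))                              ≡⟨ enum-index (v k) ⟩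
    v k                                             ∎

  code-vector : ∀ m (n : Fin (Q ℕ.^ m)) {v} → v ≗ vector m n → code v ≡ n
  code-vector m n {v} v≗ = Fin.toℕ-injective (begin
    toℕ (code v)                               ≡⟨ Fin.toℕ-fromℕ< (encode< (index ∘ v)) ⟩
    encode (index ∘ v)                         ≡⟨ encode-cong (λ k → trans (cong index (v≗ k)) (index-enum (digit F (toℕ n) (toℕ k)))) ⟩
    encode {m} (λ k → digit F (toℕ n) (toℕ k)) ≡⟨ encode-digit m (toℕ n) (Fin.toℕ<n n) ⟩
    toℕ n                                      ∎)

  translation : ∀ {m} → (Fin m → Carrier) → Permutation (Q ℕ.^ m) (Q ℕ.^ m)
  translation {m} w = permutation (shift w) (shift (-_ ∘ w)) there back
    where
      shift : (Fin m → Carrier) → Fin (Q ℕ.^ m) → Fin (Q ℕ.^ m)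
      shift w n = code (λ k → vector m n k + w k)
      undo : ∀ x {y z} → y + z ≡ 0# → x + y + z ≡ x
      undo x {y} {z} eq = trans (+-assoc x y z) (trans (cong (x +_) eq) (+-identityʳ x))
      there : ∀ n → shift w (shift (-_ ∘ w) n) ≡ n
      there n = code-vector m n (λ k → trans (cong (_+ w k) (vector-code (λ k → vector m n k - w k) k)) (undo (vector m n k) (-‿inverseˡ (w k))))
      back : ∀ n → shift (-_ ∘ w) (shift w n) ≡ n
      back n = code-vector m n (λ k → trans (cong (_- w k) (vector-code (λ k → vector m n k + w k) k)) (undo (vector m n k) (-‿inverseʳ (w k))))

  infix 7 _∙_
  _∙_ : ∀ {m} → (Fin m → Carrier) → (Fin m → Carrier) → Carrier
  a ∙ v = ∑ (λ k → a k * v k)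

  ∙-cong : ∀ {m} (a : Fin m → Carrier) {v w} → v ≗ w → a ∙ v ≡ a ∙ w
  ∙-cong a v≗w = ∑-cong (λ k → cong (a k *_) (v≗w k))

  ∙-+ : ∀ {m} (a v w : Fin m → Carrier) → a ∙ (λ k → v k + w k) ≡ a ∙ v + a ∙ w
  ∙-+ a v w = trans (∑-cong (λ k → distribˡ (a k) (v k) (w k))) (∑-distrib-+ (λ k → a k * v k) (λ k → a k * w k))

  Surjective : ∀ {m} {I : Set} → (I → Fin m → Carrier) → Set
  Surjective {m} {I} A = ∀ (τ : I → Carrier) → ∃ λ v → ∀ i → A i ∙ v ≡ τ i

  solution? : ∀ {m D} (A : Fin D → Fin m → Carrier) (τ : Fin D → Carrier) (n : Fin (Q ℕ.^ m)) →
              Dec (∀ k → A k ∙ vector m n ≡ τ k)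
  solution? {m} A τ n = Fin.all? (λ k → A k ∙ vector m n ≟ τ k)

  -- Translation by a preimage w of τ - τ′ carries the solutions for τ′ bijectively to those for τ.
  count-translate : ∀ {m D} (A : Fin D → Fin m → Carrier) → Surjective A → ∀ (τ τ′ : Fin D → Carrier) →
                    count (solution? A τ) ≡ count (solution? A τ′)
  count-translate {m} A surjective τ τ′ = trans (count-permute (solution? A τ) (translation w))
    (count-cong (λ n → solution? A τ (translation w ⟨$⟩ʳ n)) (solution? A τ′)
      (λ n sol k → +-cancelʳ (A k ∙ w) (A k ∙ vector m n) (τ′ k) (trans (sym (moved n k)) (trans (sol k) (target k))))
      (λ n sol k → trans (moved n k) (trans (cong (_+ A k ∙ w) (sol k)) (sym (target k)))))
    where
      w = proj₁ (surjective (λ k → τ k - τ′ k))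
      target : ∀ k → τ k ≡ τ′ k + A k ∙ w
      target k = trans (y≡x+[y-x] (τ′ k) (τ k)) (cong (τ′ k +_) (sym (proj₂ (surjective (λ k → τ k - τ′ k)) k)))
      moved : ∀ n k → A k ∙ vector m (translation w ⟨$⟩ʳ n) ≡ A k ∙ vector m n + A k ∙ w
      moved n k = trans (∙-cong (A k) (vector-code (λ k → vector m n k + w k))) (∙-+ (A k) (vector m n) w)

  -- Dropping the first equation merges the Q fibres given by the value of the first functional. By
  -- translation they have equal size, so each further equation divides the count by Q.
  equidistributed : ∀ {m} D (A : Fin D → Fin m → Carrier) → Surjective A → ∀ (τ : Fin D → Carrier) →
                    count (solution? A τ) ℕ.* Q ℕ.^ D ≡ Q ℕ.^ m
  equidistributed {m} zero    A surjective τ = trans (ℕ.*-identityʳ _) (count-all (solution? A τ) (λ _ ()))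
  equidistributed {m} (suc D) A surjective τ = begin
    c ℕ.* (Q ℕ.* Q ℕ.^ D)                              ≡⟨ ℕ.*-assoc c Q (Q ℕ.^ D) ⟨
    c ℕ.* Q ℕ.* Q ℕ.^ D                                ≡⟨ cong (ℕ._* Q ℕ.^ D) (trans (ℕ.*-comm c Q) (sym (∑ℕ-const Q c))) ⟩
    ∑ℕ {Q} (λ _ → c) ℕ.* Q ℕ.^ D                       ≡⟨ cong (ℕ._* Q ℕ.^ D) (∑ℕ-cong (λ x → count-translate A surjective τ (value x))) ⟩
    ∑ℕ (λ x → count (solution? A (value x))) ℕ.* Q ℕ.^ D
      ≡⟨ cong (ℕ._* Q ℕ.^ D) (count-fibres (λ n → index (A zero ∙ vector m n)) (solution? (λ k → A (suc k)) (λ k → τ (suc k)))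
           (λ x → solution? A (value x)) extend (λ {x} sol → (λ k → sol (suc k)) , trans (cong index (sol zero)) (index-enum x))) ⟨
    count (solution? (λ k → A (suc k)) (λ k → τ (suc k))) ℕ.* Q ℕ.^ D  ≡⟨ equidistributed D (λ k → A (suc k)) tail-surjective (λ k → τ (suc k)) ⟩
    Q ℕ.^ m                                            ∎
    where
      c = count (solution? A τ)
      cons : Carrier → (Fin D → Carrier) → Fin (suc D) → Carrier
      cons y σ zero    = y
      cons y σ (suc k) = σ k
      value : Fin Q → Fin (suc D) → Carrier
      value x = cons (enum x) (λ k → τ (suc k))
      extend : ∀ {n} → (∀ k → A (suc k) ∙ vector m n ≡ τ (suc k)) →
               ∀ k → A k ∙ vector m n ≡ value (index (A zero ∙ vector m n)) k
      extend sol zero    = sym (enum-index _)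
      extend sol (suc k) = sol k
      tail-surjective : Surjective (λ k → A (suc k))
      tail-surjective σ = let v , eq = surjective (cons 0# σ) in v , λ k → eq (suc k)

component≤sumℕ : ∀ {s} (d : Fin s → ℕ) i → d i ≤ sumℕ d
component≤sumℕ d zero    = ℕ.m≤m+n (d zero) _
component≤sumℕ d (suc i) = ℕ.m≤n⇒m≤o+n (d zero) (component≤sumℕ (d ∘ suc) i)

-- The net property as joint surjectivity of leading rows

module NetCriterion {Q : ℕ} (F : FiniteField Q) where
  open FieldTheory F
  open Nets F
  open ≡-Reasoning

  sumF≡∑ : ∀ {n} (f : Fin n → Carrier) → sumF F f ≡ ∑ f
  sumF≡∑ {zero}  f = refl
  sumF≡∑ {suc n} f = cong (f zero +_) (sumF≡∑ (f ∘ suc))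

  JointlySurjective : ∀ {m s} (d : Fin s → ℕ) → (∀ i → Fin (d i) → Fin m → Carrier) → Set
  JointlySurjective d A = ∀ (τ : ∀ i → Fin (d i) → Carrier) → ∃ λ v → ∀ i j → A i j ∙ v ≡ τ i j

  count-solutions : ∀ {m s} (d : Fin s → ℕ) (A : ∀ i → Fin (d i) → Fin m → Carrier) → JointlySurjective d A →
                    ∀ τ {P : Fin (Q ℕ.^ m) → Set} (P? : ∀ n → Dec (P n)) →
                    (∀ n → P n → ∀ i j → A i j ∙ vector m n ≡ τ i j) →
                    (∀ n → (∀ i j → A i j ∙ vector m n ≡ τ i j) → P n) →
                    count P? ℕ.* Q ℕ.^ sumℕ d ≡ Q ℕ.^ m
  count-solutions {m} {s} d A surjective τ P? sound complete = trans
    (cong (ℕ._* Q ℕ.^ sumℕ d) (count-cong P? (solution? flat-A flat-τ)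
      (λ n p k → sound n p _ _)
      (λ n sol → complete n (λ i j → subst (λ ij → uncurry A ij ∙ vector m n ≡ uncurry τ ij)
                                           (splitΣ-joinΣ d (i , j)) (sol (joinΣ d (i , j)))))))
    (equidistributed (sumℕ d) flat-A flat-surjective flat-τ)
    where
      flat-A : Fin (sumℕ d) → Fin m → Carrier
      flat-A = uncurry A ∘ splitΣ d
      flat-τ : Fin (sumℕ d) → Carrier
      flat-τ = uncurry τ ∘ splitΣ d
      flat-surjective : Surjective flat-A
      flat-surjective σ with v , eq ← surjective (λ i j → σ (joinΣ d (i , j))) =
        v , λ k → trans (uncurry eq (splitΣ d k)) (cong σ (joinΣ-splitΣ d k))

  instance
    _ : NonZero Q
    _ = Q-nonZero F

  -- The target τ, passed through the bijections κ, prescribes leading digits and so an elementary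
  -- interval. The net has a point in it, because an empty box would give Q^m = 0; the η-image of
  -- the index of that point is the required vector.
  net⇒surjective : ∀ {u m s} {e : Fin s → ℕ} (D : DigitalData F m s) → IsNet Q u m s e (digitalPoints F D) →
                   ∀ d (d≤m : ∀ i → d i ≤ m) → Q ℕ.^ (u ℕ.+ sumℕ d) ≤ Q ℕ.^ m → (∀ i → e i ∣ d i) →
                   JointlySurjective d (λ i j → DigitalData.C D i (inject≤ j (d≤m i)))
  net⇒surjective {m = m} {s} D (_ , net) d d≤m large e∣d τ =
    (λ k → Bijection.to (η k) (digit F (toℕ n) (toℕ k))) , λ i j → trans (sym (sumF≡∑ {m} _))
      (Bijection.injective (κ i (inject≤ j (d≤m i)))
        (inCoord⇒digits (d≤m i) (λ j → Bijection.to (κ i j) (y i j)) (target i) (proj₂ hit i) j))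
    where
      open DigitalData D
      target : ∀ i → Fin (d i) → Fin Q
      target i j = Bijection.to (κ i (inject≤ j (d≤m i))) (τ i j)
      J : ElemInterval Q s
      J = elem d (λ i → toℕ (funToFin (target i))) (λ i → Fin.toℕ<n (funToFin (target i)))
      hit : ∃ λ n → InBox {m = m} J (digitalPoints F D n)
      hit = count-witness (λ n → inBox? {m = m} J (digitalPoints F D n)) λ c≡0 →
        ℕ.≢-nonZero⁻¹ (Q ℕ.^ m) {{ℕ.m^n≢0 Q m}} (trans (sym (net J large e∣d)) (cong (ℕ._* Q ℕ.^ sumℕ d) c≡0))
      n = proj₁ hit
      y : Fin s → Fin m → Carrier
      y i j = sumF F λ k → C i j k * Bijection.to (η k) (digit F (toℕ n) (toℕ k))

  module _ {m s : ℕ} (A : Fin s → Fin m → Fin m → Carrier) where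
    digitalData : DigitalData F m s
    digitalData = record
      { C = A
      ; η = λ _ → enumeration
      ; κ = λ _ _ → mk⤖ ((λ {x} {y} eq → trans (sym (enum-index x)) (trans (cong enum eq) (enum-index y))) ,
                         (λ i → enum i , λ { refl → index-enum i })) }

    -- Writing each a_i in d_i digits turns membership in the box into a linear system with Σ d_i
    -- equations, whose solutions are counted by `count-solutions`.
    surjective⇒net : ∀ {u} {e : Fin s → ℕ} → u ≤ m → 1 < Q →
                     (∀ d (d≤m : ∀ i → d i ≤ m) → u ℕ.+ sumℕ d ≤ m → (∀ i → e i ∣ d i) →
                       JointlySurjective d (λ i j → A i (inject≤ j (d≤m i)))) →
                     IsNet Q u m s e (digitalPoints F digitalData)
    surjective⇒net {u} {e} u≤m 1<Q surjective = u≤m , net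
      where
        net : ∀ (J : ElemInterval Q s) → Q ℕ.^ (u ℕ.+ sumℕ (ElemInterval.d J)) ≤ Q ℕ.^ m →
              (∀ i → e i ∣ ElemInterval.d J i) →
              count (λ n → inBox? {m = m} J (digitalPoints F digitalData n)) ℕ.* Q ℕ.^ sumℕ (ElemInterval.d J) ≡ Q ℕ.^ m
        net J@(elem d a a<) large e∣d =
          count-solutions d rows (surjective d d≤m u+D≤m e∣d) (λ i j → enum (t i j))
            (λ n → inBox? {m = m} J (digitalPoints F digitalData n)) sound complete
          where
            u+D≤m : u ℕ.+ sumℕ d ≤ m
            -- The volume condition compares powers of Q; as 1 < Q, the exponents compare likewise.
            u+D≤m = ℕ.≮⇒≥ (λ m<u+D → ℕ.<⇒≱ (ℕ.^-monoʳ-< Q 1<Q m<u+D) large)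
            d≤m : ∀ i → d i ≤ m
            d≤m i = ℕ.≤-trans (component≤sumℕ d i) (ℕ.≤-trans (ℕ.m≤n+m (sumℕ d) u) u+D≤m)
            rows : ∀ i → Fin (d i) → Fin m → Carrier
            rows i j = A i (inject≤ j (d≤m i))
            t : ∀ i → Fin (d i) → Fin Q
            t i = finToFun (fromℕ< (a< i))
            a≡ : ∀ i → toℕ (funToFin (t i)) ≡ a i
            a≡ i = trans (cong toℕ (Fin.funToFin-finToFin {d i} {Q} (fromℕ< (a< i)))) (Fin.toℕ-fromℕ< (a< i))
            digits : Fin (Q ℕ.^ m) → ∀ i → Fin m → Fin Q
            digits n i j = index (sumF F (λ k → A i j k * vector m n k))
            sound : ∀ n → InBox {m = m} J (digitalPoints F digitalData n) → ∀ i j → rows i j ∙ vector m n ≡ enum (t i j)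
            sound n inBox i j = begin
              rows i j ∙ vector m n                      ≡⟨ sumF≡∑ {m} _ ⟨
              sumF F (λ k → rows i j k * vector m n k)   ≡⟨ enum-index _ ⟨
              enum (digits n i (inject≤ j (d≤m i)))      ≡⟨ cong enum (inCoord⇒digits (d≤m i) (digits n i) (t i)
                                                              (subst (λ a → InCoord Q m (d i) a (digitalPoints F digitalData n i)) (sym (a≡ i)) (inBox i)) j) ⟩
              enum (t i j)                               ∎
            complete : ∀ n → (∀ i j → rows i j ∙ vector m n ≡ enum (t i j)) → InBox {m = m} J (digitalPoints F digitalData n)
            complete n sol i = subst (λ a → InCoord Q m (d i) a (digitalPoints F digitalData n i)) (a≡ i)
              (digits⇒inCoord (d≤m i) (digits n i) (t i) (λ j →
                trans (cong index (trans (sumF≡∑ {m} _) (sol i j))) (index-enum (t i j))))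

-- Descent of the generating matrices from E to F

module Descent {q N p k′ r′ m′ : ℕ} (F : FiniteField q) (E : FiniteField N) (p-prime : Prime p)
               (q≡p^k : q ≡ p ℕ.^ suc k′) (N≡q^r : N ≡ q ℕ.^ suc r′) where
  private
    module F where
      open FieldTheory F public
      open Nets F public
      open NetCriterion F public
    module E where
      open FieldTheory E public
      open Polynomials E public
      open Nets E public
      open NetCriterion E public
  open Embedding {k′ = k′} {r′ = r′} F E p-prime q≡p^k N≡q^r
    using (φ; φ-0; φ-1; π; π-+; π-φ*; π-φ; coordinates; combination-coordinates; γ; 1<q)
  open ≡-Reasoning
  r m M : ℕ
  r = suc r′
  m = suc m′
  M = suc (m′ ℕ.* r)

  π-∑ : ∀ {n} (f : Fin n → E.Carrier) → π (E.∑ f) ≡ F.∑ (π ∘ f)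
  π-∑ {zero}  f = trans (cong π (sym φ-0)) (π-φ F.0#)
  π-∑ {suc n} f = trans (π-+ (f zero) _) (cong (π (f zero) F.+_) (π-∑ (f ∘ suc)))

  x[yz]≡y[xz] : ∀ x y z → x E.* (y E.* z) ≡ y E.* (x E.* z)
  x[yz]≡y[xz] x y z = trans (sym (E.*-assoc x y z)) (trans (cong (E._* z) (E.*-comm x y)) (E.*-assoc y x z))

  ev≡∑ : ∀ {n} (a : Fin n → E.Carrier) x → E.ev a x ≡ E.∑ (λ t → a t E.* x E.^ toℕ t)
  ev≡∑ {zero}  a x = refl
  ev≡∑ {suc n} a x = cong₂ E._+_ (sym (E.*-identityʳ _)) (begin
    x E.* E.ev (a ∘ suc) x                                     ≡⟨ cong (x E.*_) (ev≡∑ (a ∘ suc) x) ⟩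
    x E.* E.∑ (λ t → a (suc t) E.* x E.^ toℕ t)                ≡⟨ E.*-distribˡ-sum x (λ t → a (suc t) E.* x E.^ toℕ t) ⟩
    E.∑ (λ t → x E.* (a (suc t) E.* x E.^ toℕ t))              ≡⟨ E.∑-cong (λ t → x[yz]≡y[xz] x (a (suc t)) (x E.^ toℕ t)) ⟩
    E.∑ (λ t → a (suc t) E.* (x E.* x E.^ toℕ t))              ∎)

  -- Scaling by a nonzero constant makes the leading entry of a row 0 or 1, hence an element of F.
  record Scaling (x : E.Carrier) : Set where
    field
      factor inverse : E.Carrier
      factor-inverse : factor E.* inverse ≡ E.1#
      leading : F.Carrier
      leading-correct : φ leading ≡ factor E.* x

  scaling : ∀ x → Scaling x
  scaling x with x E.≟ E.0#
  ... | yes refl = record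
    { factor = E.1# ; inverse = E.1# ; factor-inverse = E.*-identityˡ _ ; leading = F.0#
    ; leading-correct = trans φ-0 (sym (E.zeroʳ _)) }
  ... | no x≢0 with y , xy≡1 ← E.inverse x x≢0 = record
    { factor = y ; inverse = x ; factor-inverse = trans (E.*-comm y x) xy≡1 ; leading = F.1#
    ; leading-correct = trans φ-1 (sym (trans (E.*-comm y x) xy≡1)) }

  -- All r coordinates of every entry are kept, except for the first entry, of which only the image
  -- under π survives. Index 1 + (l r + t) holds coordinate t of entry l + 1.
  descendVector : (Fin m → E.Carrier) → Fin M → F.Carrier
  descendVector v zero    = π (v zero)
  descendVector v (suc k) = let l , t = remQuot r k in coordinates (v (suc l)) t

  module _ (c : Fin m → E.Carrier) where
    open Scaling (scaling (c zero))

    scaled : Fin m → E.Carrier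
    scaled l = factor E.* c l

    -- The matrix of v ↦ π⟨scaled, v⟩ in the coordinates of `descendVector`: its later entries are
    -- the values of the functional at γ^t in position l + 1.
    descend : Fin M → F.Carrier
    descend zero    = leading
    descend (suc k) = let l , t = remQuot r k in π (scaled (suc l) E.* γ E.^ toℕ t)

    -- The first summand needs the scaling: π(x v₀) is determined by π(v₀) when x = φ(`leading`), by
    -- F-linearity. In the other blocks v is expanded in the basis of powers of γ.
    descend-∙ : ∀ v → descend F.∙ descendVector v ≡ π (scaled E.∙ v)
    descend-∙ v = begin
      leading F.* π (v zero) F.+ F.∑ (λ k → term (remQuot r k))
        ≡⟨ cong₂ F._+_ first rest ⟩
      π (scaled zero E.* v zero) F.+ π (E.∑ (λ l → scaled (suc l) E.* v (suc l)))
        ≡⟨ π-+ _ _ ⟨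
      π (scaled E.∙ v) ∎
      where
        term : Fin m′ × Fin r → F.Carrier
        term (l , t) = π (scaled (suc l) E.* γ E.^ toℕ t) F.* coordinates (v (suc l)) t
        first : leading F.* π (v zero) ≡ π (scaled zero E.* v zero)
        first = trans (sym (π-φ* leading (v zero))) (cong (λ y → π (y E.* v zero)) leading-correct)
        block : ∀ l → F.∑ (λ t → term (l , t)) ≡ π (scaled (suc l) E.* v (suc l))
        block l = begin
          F.∑ (λ t → π (a E.* γ E.^ toℕ t) F.* w t)              ≡⟨ F.∑-cong (λ t → trans (F.*-comm _ (w t)) (sym (π-φ* (w t) (a E.* γ E.^ toℕ t)))) ⟩
          F.∑ (λ t → π (φ (w t) E.* (a E.* γ E.^ toℕ t)))        ≡⟨ π-∑ (λ t → φ (w t) E.* (a E.* γ E.^ toℕ t)) ⟨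
          π (E.∑ (λ t → φ (w t) E.* (a E.* γ E.^ toℕ t)))        ≡⟨ cong π (E.∑-cong (λ t → x[yz]≡y[xz] (φ (w t)) a (γ E.^ toℕ t))) ⟩
          π (E.∑ (λ t → a E.* (φ (w t) E.* γ E.^ toℕ t)))        ≡⟨ cong π (E.*-distribˡ-sum a (λ t → φ (w t) E.* γ E.^ toℕ t)) ⟨
          π (a E.* E.∑ (λ t → φ (w t) E.* γ E.^ toℕ t))          ≡⟨ cong (λ y → π (a E.* y)) (trans (sym (ev≡∑ (φ ∘ w) γ)) (combination-coordinates (v (suc l)))) ⟩
          π (a E.* v (suc l))                                    ∎
          where
            a = scaled (suc l)
            w = coordinates (v (suc l))
        rest : F.∑ (λ k → term (remQuot r k)) ≡ π (E.∑ (λ l → scaled (suc l) E.* v (suc l)))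
        rest = begin
          F.∑ {m′ ℕ.* r} (λ k → term (remQuot r k))               ≡⟨ sum-combine F.+-commutativeMonoid m′ {r} (λ k → term (remQuot r k)) ⟩
          F.∑ {m′} (λ l → F.∑ {r} (λ t → term (remQuot r (combine l t))))  ≡⟨ F.∑-cong {m′} (λ l → F.∑-cong {r} (λ t → cong term (Fin.remQuot-combine l t))) ⟩
          F.∑ (λ l → F.∑ (λ t → term (l , t)))                    ≡⟨ F.∑-cong block ⟩
          F.∑ (λ l → π (scaled (suc l) E.* v (suc l)))            ≡⟨ π-∑ (λ l → scaled (suc l) E.* v (suc l)) ⟨
          π (E.∑ (λ l → scaled (suc l) E.* v (suc l)))            ∎

    scaled-∙ : ∀ v {τ} → c E.∙ v ≡ inverse E.* τ → scaled E.∙ v ≡ τ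
    scaled-∙ v {τ} eq = begin
      E.∑ (λ l → factor E.* c l E.* v l)    ≡⟨ E.∑-cong (λ l → E.*-assoc factor (c l) (v l)) ⟩
      E.∑ (λ l → factor E.* (c l E.* v l))  ≡⟨ E.*-distribˡ-sum factor (λ l → c l E.* v l) ⟨
      factor E.* (c E.∙ v)                  ≡⟨ cong (factor E.*_) eq ⟩
      factor E.* (inverse E.* τ)            ≡⟨ E.*-assoc factor inverse τ ⟨
      factor E.* inverse E.* τ              ≡⟨ cong (E._* τ) factor-inverse ⟩
      E.1# E.* τ                            ≡⟨ E.*-identityˡ τ ⟩
      τ                                     ∎

  module _ {s : ℕ} (C : Fin s → Fin m → Fin m → E.Carrier) where

    rows : Fin s → Fin M → Fin M → F.Carrier
    rows i j with toℕ j ℕ.<? m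
    ... | yes j<m = descend (C i (fromℕ< j<m))
    -- Filler that makes the matrix square: the admissible d_i never exceed m, so no condition
    -- reaches these rows.
    ... | no  _   = λ _ → F.0#

    rows-descend : ∀ i {d} (d≤m : d ≤ m) (d≤M : d ≤ M) (j : Fin d) →
                   rows i (inject≤ j d≤M) ≡ descend (C i (inject≤ j d≤m))
    rows-descend i d≤m d≤M j with toℕ (inject≤ j d≤M) ℕ.<? m
    ... | yes j<m = cong (descend ∘ C i) (Fin.toℕ-injective (trans (Fin.toℕ-fromℕ< j<m)
                      (trans (Fin.toℕ-inject≤ j d≤M) (sym (Fin.toℕ-inject≤ j d≤m)))))
    ... | no j≮m  = contradiction (subst (_< m) (sym (Fin.toℕ-inject≤ j d≤M)) (ℕ.<-≤-trans (Fin.toℕ<n j) d≤m)) j≮m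

    rows-surjective : ∀ d (d≤m : ∀ i → d i ≤ m) (d≤M : ∀ i → d i ≤ M) →
                      E.JointlySurjective d (λ i j → C i (inject≤ j (d≤m i))) →
                      F.JointlySurjective d (λ i j → rows i (inject≤ j (d≤M i)))
    rows-surjective d d≤m d≤M surjective τ = descendVector v , λ i j → begin
      rows i (inject≤ j (d≤M i)) F.∙ descendVector v          ≡⟨ cong (F._∙ descendVector v) (rows-descend i (d≤m i) (d≤M i) j) ⟩
      descend (C i (inject≤ j (d≤m i))) F.∙ descendVector v   ≡⟨ descend-∙ (C i (inject≤ j (d≤m i))) v ⟩
      π (scaled (C i (inject≤ j (d≤m i))) E.∙ v)              ≡⟨ cong π (scaled-∙ (C i (inject≤ j (d≤m i))) v (proj₂ solution i j)) ⟩
      π (φ (τ i j))                                           ≡⟨ π-φ (τ i j) ⟩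
      τ i j                                                   ∎
      where
        -- The inverse factor cancels the scaling of the row, so the scaled functional takes exactly
        -- the value φ(τ), which π sends back to τ.
        solution = surjective (λ i j → Scaling.inverse (scaling (C i (inject≤ j (d≤m i)) zero)) E.* φ (τ i j))
        v = proj₁ solution

  -- Dimension and u grow by the same amount r′m′, so u + Σ d_i ≤ m is recovered from the
  -- corresponding bound for the new net by cancellation.
  M≡r′m′+m : M ≡ r′ ℕ.* m′ ℕ.+ m
  M≡r′m′+m = begin
    suc (m′ ℕ.* r)            ≡⟨ cong suc (ℕ.*-suc m′ r′) ⟩
    suc (m′ ℕ.+ m′ ℕ.* r′)    ≡⟨ cong (m ℕ.+_) (ℕ.*-comm m′ r′) ⟩
    m ℕ.+ r′ ℕ.* m′           ≡⟨ ℕ.+-comm m (r′ ℕ.* m′) ⟩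
    r′ ℕ.* m′ ℕ.+ m           ∎

  descendNet : ∀ {u s} {e : Fin s → ℕ} → ExistsDigitalNet E u m s e → ExistsDigitalNet F (r′ ℕ.* m′ ℕ.+ u) M s e
  descendNet {u} {s} {e} (D , net) = F.digitalData A ,
    F.surjective⇒net A (subst (r′ ℕ.* m′ ℕ.+ u ≤_) (sym M≡r′m′+m) (ℕ.+-monoʳ-≤ (r′ ℕ.* m′) (proj₁ net))) 1<q surjective
    where
      A = rows (DigitalData.C D)
      surjective : ∀ d (d≤M : ∀ i → d i ≤ M) → r′ ℕ.* m′ ℕ.+ u ℕ.+ sumℕ d ≤ M → (∀ i → e i ∣ d i) →
                   F.JointlySurjective d (λ i j → A i (inject≤ j (d≤M i)))
      surjective d d≤M sum≤M e∣d = rows-surjective (DigitalData.C D) d d≤m d≤M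
        (E.net⇒surjective D net d d≤m (ℕ.^-monoʳ-≤ N {{Q-nonZero E}} u+D≤m) e∣d)
        where
          u+D≤m : u ℕ.+ sumℕ d ≤ m
          u+D≤m = ℕ.+-cancelˡ-≤ (r′ ℕ.* m′) _ _ (subst₂ _≤_ (ℕ.+-assoc (r′ ℕ.* m′) u (sumℕ d)) M≡r′m′+m sum≤M)
          d≤m : ∀ i → d i ≤ m
          d≤m i = ℕ.≤-trans (component≤sumℕ d i) (ℕ.≤-trans (ℕ.m≤n+m (sumℕ d) u) u+D≤m)

-- The parameters of the statement

open import Data.Nat using (_+_; _*_; _^_)

theorem3 : (q m s u r : ℕ) → IsPrimePower q → 1 ≤ m → 1 ≤ s → 2 ≤ r →
    (e : Fin s → ℕ) → (∀ i → 1 ≤ e i) →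
    (Fr : FiniteField (q ^ r)) → (F : FiniteField q) →
    ExistsDigitalNet Fr u m s e →
    ExistsDigitalNet F ((r ∸ 1) * m ∸ (r ∸ 1) + u) (r * m ∸ (r ∸ 1)) s e
theorem3 q (suc m′) s u (suc r′) (p , suc k′ , p-prime , _ , q≡p^k) _ _ _ e _ Fr F net =
  -- With r = r′ + 1 and m = m′ + 1, the truncated differences are r′m′ and 1 + m′r.
  subst₂ (λ u M → ExistsDigitalNet F u M s e)
    (cong (_+ u) (sym (trans (cong (_∸ r′) (ℕ.*-suc r′ m′)) (ℕ.m+n∸m≡n r′ (r′ * m′)))))
    (sym (begin
      suc r′ * suc m′ ∸ r′           ≡⟨ cong (_∸ r′) (ℕ.*-comm (suc r′) (suc m′)) ⟩
      suc (r′ + m′ * suc r′) ∸ r′    ≡⟨ cong (_∸ r′) (ℕ.+-suc r′ (m′ * suc r′)) ⟨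
      r′ + suc (m′ * suc r′) ∸ r′    ≡⟨ ℕ.m+n∸m≡n r′ (suc (m′ * suc r′)) ⟩
      suc (m′ * suc r′)              ∎))
    (Descent.descendNet {k′ = k′} {r′ = r′} F Fr p-prime q≡p^k refl net)
  where open ≡-Reasoning
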